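{- There is an algorithm which, given a tree $T$ on $n$ vertices, decides in $\mathcal{O}(n^2)$ time whether $wr(T)=2$ (more precisely, whether $wr(T)\le 2$).
   Context: All graphs are finite, simple and undirected. For a set $E'$ of edges of a graph, the subgraph induced by $E'$ is the graph whose edge set is $E'$ and whose vertex set is the set of endpoints of edges in $E'$. A graph is weakly semiregular if there are two numbers $a,b$ (not necessarily distinct) such that the degree of every vertex is $a$ or $b$. The weakly semiregular number $wr(G)$ of a graph $G$ is the minimum number of subsets into which $E(G)$ can be partitioned so that the subgraph induced by each subset is weakly semiregular. -}

module Defs where

open import Data.Bool.Base using (if_then_else_)
open import Data.Fin.Base using (Fin; toℕ)
open import Data.Fin.Subset using (Subset; _∈_; _∉_; _⊆_; ∣_∣; Nonempty; ⊤)
open import Data.Fin.Subset.Properties using (nonempty?)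
open import Data.List.Base using (List; []; _∷_; [_]; _++_; length; map)
open import Data.List.Membership.Propositional using () renaming (_∈_ to _∈ˡ_)
open import Data.List.Relation.Unary.AllPairs using (AllPairs)
open import Data.List.Relation.Unary.Linked using (Linked)
open import Data.List.Relation.Unary.Unique.Propositional using (Unique)
open import Data.Nat.Base using (ℕ; zero; suc; _+_; _*_; _∸_; _≤_)
open import Data.Nat.Properties using (_≟_)
open import Data.Product.Base using (_×_; _,_; ∃-syntax; ∃₂; proj₁; proj₂; swap)
open import Data.Sum.Base using (_⊎_)
open import Data.Vec.Base using (tabulate)
open import Data.Vec.Properties using (lookup∘tabulate; lookup⇒[]=)
open import Function.Bundles using (_⇔_)
open import Relation.Binary.Construct.Closure.ReflexiveTransitive using (Star)
open import Relation.Binary.PropositionalEquality using (_≡_; _≢_; trans)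
open import Relation.Nullary using (¬_)
open import Relation.Nullary.Decidable using (does; dec-true)

------------------------------------------------------------------------
-- Graphs

-- The vertex set is a subset of Fin N rather than all of Fin N, so that a
-- subgraph induced by a set of edges is again a Graph N.
record Graph (N : ℕ) : Set where
  field
    vertices    : Subset N
    neighbours  : Fin N → Subset N
    symmetric   : ∀ {u v} → v ∈ neighbours u → u ∈ neighbours v
    irreflexive : ∀ {v} → v ∉ neighbours v
    incident    : ∀ {u v} → v ∈ neighbours u → u ∈ vertices

  Adjacent : Fin N → Fin N → Set
  Adjacent u v = v ∈ neighbours u

  degree : Fin N → ℕ
  degree v = ∣ neighbours v ∣

open Graph public using (vertices; neighbours; Adjacent; degree)

module _ {N : ℕ} (G : Graph N) where

  Connected : Set
  Connected = Nonempty (vertices G) ×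
    (∀ {u v} → u ∈ vertices G → v ∈ vertices G → Star (Adjacent G) u v)

  IsCycle : Fin N → List (Fin N) → Set
  IsCycle v vs =
    2 ≤ length vs × Unique (v ∷ vs) × Linked (Adjacent G) (v ∷ vs ++ [ v ])

  Acyclic : Set
  Acyclic = ∀ v vs → ¬ IsCycle v vs

  IsTree : Set
  IsTree = Connected × Acyclic

  WeaklySemiregular : Set
  WeaklySemiregular =
    ∃₂ λ a b → ∀ {v} → v ∈ vertices G → degree G v ≡ a ⊎ degree G v ≡ b

-- A set of edges of G, where  v ∈ ends u  means that the edge uv belongs to it.
record EdgeSet {N : ℕ} (G : Graph N) : Set where
  field
    ends      : Fin N → Subset N
    symmetric : ∀ {u v} → v ∈ ends u → u ∈ ends v
    ⊆edges    : ∀ {u} → ends u ⊆ neighbours G u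

open EdgeSet public using (ends)

module _ {N : ℕ} {G : Graph N} (E : EdgeSet G) where

  endpoints : Subset N
  endpoints = tabulate λ v → does (nonempty? (ends E v))

  ∈endpoints : ∀ {u v} → v ∈ ends E u → u ∈ endpoints
  ∈endpoints {u} v∈ = lookup⇒[]= u _
    (trans (lookup∘tabulate _ u) (dec-true (nonempty? (ends E u)) (_ , v∈)))

  induced : Graph N
  induced = record
    { vertices    = endpoints
    ; neighbours  = ends E
    ; symmetric   = EdgeSet.symmetric E
    ; irreflexive = λ v∈ → Graph.irreflexive G (EdgeSet.⊆edges E v∈)
    ; incident    = ∈endpoints
    }

record EdgePartition {N : ℕ} (G : Graph N) (k : ℕ) : Set where
  field
    part     : Fin k → EdgeSet G
    nonempty : ∀ i → ∃₂ λ u v → v ∈ ends (part i) u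
    covering : ∀ {u v} → Adjacent G u v → ∃[ i ] v ∈ ends (part i) u
    disjoint : ∀ {i j u v} → v ∈ ends (part i) u → v ∈ ends (part j) u → i ≡ j

open EdgePartition public using (part)

module _ {N : ℕ} (G : Graph N) where

  WeaklySemiregularPartition : ℕ → Set
  WeaklySemiregularPartition k =
    ∃[ P ] ∀ (i : Fin k) → WeaklySemiregular (induced (part {G = G} P i))

  -- wr(G) = k
  wr≡ : ℕ → Set
  wr≡ k = WeaklySemiregularPartition k ×
          (∀ j → WeaklySemiregularPartition j → k ≤ j)

  -- wr(G) ≤ k
  wr≤ : ℕ → Set
  wr≤ k = ∃[ m ] wr≡ m × m ≤ k

------------------------------------------------------------------------
-- Model of computation: structured programs for a random access machine
-- with addition and (truncated) subtraction under the uniform cost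
-- criterion.  A program is a finite piece of syntax, hence independent of
-- the input, and mentions only finitely many registers and arrays.

data Expr : Set where
  lit  : ℕ → Expr
  reg  : ℕ → Expr
  cell : ℕ → Expr → Expr
  add  : Expr → Expr → Expr
  sub  : Expr → Expr → Expr

infixr 5 _⨾_

data Program : Set where
  skip  : Program
  set   : ℕ → Expr → Program
  store : ℕ → Expr → Expr → Program
  _⨾_   : Program → Program → Program
  cond  : Expr → Program → Program → Program
  while : Expr → Program → Program

record State : Set where
  constructor state
  field
    register : ℕ → ℕ
    array    : ℕ → ℕ → ℕ

open State public

update : {A : Set} → ℕ → A → (ℕ → A) → (ℕ → A)
update x a f y = if does (x ≟ y) then a else f y

setRegister : ℕ → ℕ → State → State
setRegister x v s = state (update x v (register s)) (array s)

setCell : ℕ → ℕ → ℕ → State → State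
setCell a i v s =
  state (register s) (update a (update i v (array s a)) (array s))

eval : Expr → State → ℕ
eval (lit k)    s = k
eval (reg x)    s = register s x
eval (cell a e) s = array s a (eval e s)
eval (add e f)  s = eval e s + eval f s
eval (sub e f)  s = eval e s ∸ eval f s

cost : Expr → ℕ
cost (lit k)    = 1
cost (reg x)    = 1
cost (cell a e) = suc (cost e)
cost (add e f)  = suc (cost e + cost f)
cost (sub e f)  = suc (cost e + cost f)

-- ⟨ p , s ⟩⇓[ t ] s′ : started in s, the program p halts in s′ after t steps.
-- A condition holds when its value is nonzero.
infix 4 ⟨_,_⟩⇓[_]_

data ⟨_,_⟩⇓[_]_ : Program → State → ℕ → State → Set where
  ⇓skip  : ∀ {s} → ⟨ skip , s ⟩⇓[ 1 ] s
  ⇓set   : ∀ {x e s} →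
           ⟨ set x e , s ⟩⇓[ suc (cost e) ] setRegister x (eval e s) s
  ⇓store : ∀ {a e f s} →
           ⟨ store a e f , s ⟩⇓[ suc (cost e + cost f) ]
             setCell a (eval e s) (eval f s) s
  ⇓seq   : ∀ {p q s s′ s″ t t′} →
           ⟨ p , s ⟩⇓[ t ] s′ → ⟨ q , s′ ⟩⇓[ t′ ] s″ →
           ⟨ p ⨾ q , s ⟩⇓[ t + t′ ] s″
  ⇓then  : ∀ {e p q s s′ t} → eval e s ≢ 0 →
           ⟨ p , s ⟩⇓[ t ] s′ → ⟨ cond e p q , s ⟩⇓[ suc (cost e + t) ] s′
  ⇓else  : ∀ {e p q s s′ t} → eval e s ≡ 0 →
           ⟨ q , s ⟩⇓[ t ] s′ → ⟨ cond e p q , s ⟩⇓[ suc (cost e + t) ] s′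
  ⇓loop  : ∀ {e p s s′ s″ t t′} → eval e s ≢ 0 →
           ⟨ p , s ⟩⇓[ t ] s′ → ⟨ while e p , s′ ⟩⇓[ t′ ] s″ →
           ⟨ while e p , s ⟩⇓[ suc (cost e + (t + t′)) ] s″
  ⇓exit  : ∀ {e p s} → eval e s ≡ 0 →
           ⟨ while e p , s ⟩⇓[ suc (cost e) ] s

------------------------------------------------------------------------
-- Algorithms on trees

-- Every edge is listed exactly once, in one of its two orientations.
IsEdgeList : {N : ℕ} → Graph N → List (Fin N × Fin N) → Set
IsEdgeList G es =
  (∀ u v → Adjacent G u v ⇔ ((u , v) ∈ˡ es ⊎ (v , u) ∈ˡ es)) ×
  AllPairs (λ e f → e ≢ f × e ≢ swap f) es

contents : List ℕ → ℕ → ℕ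
contents []       i       = 0
contents (x ∷ xs) zero    = x
contents (x ∷ xs) (suc i) = contents xs i

-- Register 0 holds the number of vertices, register 1 the number of edges,
-- and cell i of arrays 0 and 1 the two ends of the i-th edge.
input : (n : ℕ) → List (Fin n × Fin n) → State
input n es = state
  (contents (n ∷ length es ∷ []))
  λ { 0 → contents (map (λ e → toℕ (proj₁ e)) es)
    ; 1 → contents (map (λ e → toℕ (proj₂ e)) es)
    ; _ → λ _ → 0
    }

output : State → ℕ
output s = register s 0

_∈O_ : (ℕ → ℕ) → (ℕ → ℕ) → Set
f ∈O g = ∃₂ λ c n₀ → ∀ n → n₀ ≤ n → f n ≤ c * g n

-- p decides the property Q of trees, within f n steps on every tree on n
-- vertices, for every edge list presenting the tree.
DecidesOnTrees : Program → (∀ {n} → Graph n → Set) → (ℕ → ℕ) → Set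
DecidesOnTrees p Q f =
  ∀ n (T : Graph n) → vertices T ≡ ⊤ → IsTree T →
  ∀ es → IsEdgeList T es →
  ∃₂ λ t s → ⟨ p , input n es ⟩⇓[ t ] s × t ≤ f n ×
    ((Q T × output s ≡ 1) ⊎ (¬ Q T × output s ≡ 0))

module Submission where

-- A nonempty forest has a leaf, so wr(T) ≤ 2 means that the edges of T can be
-- coloured red and blue such that, for some α and β, all red degrees lie in
-- {0, 1, α} and all blue degrees in {0, 1, β}.  Let D be the maximal degree.
-- The two colour degrees of a vertex of degree D add up to D, and this leaves,
-- up to swapping the colours, only the linearly many pairs (D, x), (D ∸ 1, x)
-- and (x, D ∸ x).
--
-- For a fixed pair a colouring is sought greedily in linear time.  List the edges
-- in an order in which T grows from vertex 0 and remove them in the reverse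
-- order.  When the edge from c to its parent p is removed, all other edges at c
-- are gone, and c only remembers how many of them were forced to be red and how
-- many were forced to be blue; the others could take either colour.  This tells
-- which colours the edge pc admits.  If there is none, the pair fails; if there
-- is one, p counts a forced edge; if both are possible, the edge can be forgotten,
-- because p may choose its colour at the end.

open import Defs
open import Data.Bool.Base using (if_then_else_)
open import Data.Empty using () renaming (⊥ to Empty)
open import Data.Fin.Base using (Fin; zero; suc; toℕ; fromℕ<) renaming (_<_ to _<ᶠ_)
open import Data.Fin.Properties using (any?; all?; toℕ<n; toℕ-fromℕ<; toℕ-injective; injective⇒≤)
  renaming (_≟_ to _≟ᶠ_; <-cmp to <ᶠ-cmp)
open import Data.Fin.Subset using (Subset; _∈_; _∉_; ∣_∣; inside; outside; _-_; ⊤)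
open import Data.Fin.Subset.Properties
  using (_∈?_; nonempty?; ∣p∣≤n; ∈⊤; x∈p∧x≢y⇒x∈p-y; p─q⊆p; p─⊥≡p; Empty-unique; ∣⊥∣≡0)
open import Data.List.Base using (List; []; _∷_; [_]; _++_; length; lookup; map)
import Data.List.Membership.DecPropositional as DecMembership
open import Data.List.Membership.Propositional using () renaming (_∈_ to _∈ˡ_)
open import Data.List.Membership.Propositional.Properties using (∈-lookup)
open import Data.List.Relation.Ternary.Interleaving.Propositional
  using (Interleaving; []; consˡ; consʳ; swap)
import Data.List.Relation.Unary.All as All
open import Data.List.Relation.Unary.All using (_∷_; [])
open import Data.List.Relation.Unary.All.Properties using (¬Any⇒All¬)
open import Data.List.Relation.Unary.AllPairs using (AllPairs; []; _∷_)
open import Data.List.Relation.Unary.Any using (here; there; index)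
open import Data.List.Relation.Unary.Any.Properties using (lookup-index)
open import Data.List.Relation.Unary.Linked using (Linked; [-]; _∷_)
open import Data.List.Relation.Unary.Unique.Propositional using (Unique)
open import Data.Nat.Base
  using (ℕ; zero; suc; _+_; _*_; _∸_; _^_; _≤_; _<_; z≤n; s≤s; s≤s⁻¹)
open import Data.Nat.Properties hiding (<-cmp)
open import Data.Product.Base using (_×_; _,_; ∃; ∃₂; proj₁; proj₂)
import Data.Product.Base as Product
open import Data.Product.Properties using (≡-dec)
open import Data.Sum.Base using (_⊎_; inj₁; inj₂; [_,_]′)
import Data.Sum.Base as Sum
open import Data.Unit.Base using (tt) renaming (⊤ to Unit)
open import Data.Vec.Base using (_∷_; here; there; tabulate)
open import Data.Vec.Properties using (lookup∘tabulate; lookup⇒[]=; []=⇒lookup)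
open import Function.Base using (_∘_; id; case_of_)
open import Function.Bundles using (_⇔_; mk⇔; Equivalence)
open import Relation.Binary.Construct.Closure.ReflexiveTransitive
  using (Star; ε; _◅_; _◅◅_; reverse; gmap)
open import Relation.Binary.Definitions using (tri<; tri≈; tri>)
open import Relation.Binary.PropositionalEquality
  using (_≡_; _≢_; refl; sym; trans; cong; cong₂; subst; subst₂)
open import Relation.Nullary using (¬_; Dec; yes; no; does; contradiction)
open import Relation.Nullary.Decidable using (dec-true; dec-false; map′; _⊎-dec_)

open Equivalence using (to; from)

-- Consider a vertex of degree `d` at which `r` edges are known to be red, `b` are known to be blue
-- and the others are forgotten. Its final red degree can be any `s` from `r` to `d ∸ b`. Only the
-- values 0, 1 and `α` of `s` matter, so the existence of a suitable `s` is a test of constant cost;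
-- this is `OK`. Since `d` is always the degree in the whole tree, forgotten edges need no record:
-- they are the difference between `d` and the edges that are counted or still listed. A forgotten
-- edge at `p` keeps the interval at `p` from shrinking to a point before the edge is coloured.
-- Every removal therefore preserves feasibility in both directions, and the greedy check needs no
-- backtracking.
--
-- The input is an unsorted edge list without adjacency lists. Growing the tree by rescanning this
-- list after each attached edge takes quadratic time, which is of the same order as the linearly
-- many linear checks.

Edge : ℕ → Set
Edge N = Fin N × Fin N

-- Forests as edge lists: degrees, two-colourings and neighbourhoods

module _ {N : ℕ} where

  δ : Fin N → Fin N → ℕ
  δ u v = if does (u ≟ᶠ v) then 1 else 0

  δ-refl : ∀ v → δ v v ≡ 1
  δ-refl v rewrite dec-true (v ≟ᶠ v) refl = refl

  δ-≢ : ∀ {u v} → u ≢ v → δ u v ≡ 0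
  δ-≢ {u} {v} u≢v rewrite dec-false (u ≟ᶠ v) u≢v = refl

  deg : List (Edge N) → Fin N → ℕ
  deg []            v = 0
  deg ((p , c) ∷ L) v = δ p v + (δ c v + deg L v)

  Incident : List (Edge N) → Fin N → Fin N → Set
  Incident L u v = (u , v) ∈ˡ L ⊎ (v , u) ∈ˡ L

  Incident-sym : ∀ {L u v} → Incident L u v → Incident L v u
  Incident-sym = Sum.swap

  incident-there : ∀ {e L u v} → Incident L u v → Incident (e ∷ L) u v
  incident-there = Sum.map there there

  deg-incident : ∀ {L u v} → Incident L u v → 1 ≤ deg L u
  deg-incident {L = (p , c) ∷ L} {u} (inj₁ (here refl)) rewrite δ-refl p = s≤s z≤n
  deg-incident {L = (p , c) ∷ L} {u} (inj₁ (there i)) =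
    m≤n⇒m≤o+n (δ p u) (m≤n⇒m≤o+n (δ c u) (deg-incident (inj₁ i)))
  deg-incident {L = (p , c) ∷ L} {u} (inj₂ (here refl)) rewrite δ-refl c = m≤n⇒m≤o+n (δ p c) (s≤s z≤n)
  deg-incident {L = (p , c) ∷ L} {u} (inj₂ (there i)) =
    m≤n⇒m≤o+n (δ p u) (m≤n⇒m≤o+n (δ c u) (deg-incident (inj₂ i)))

  incident-deg : ∀ {L u} → 1 ≤ deg L u → ∃ (Incident L u)
  incident-deg {(p , c) ∷ L} {u} d with p ≟ᶠ u | c ≟ᶠ u
  ... | yes refl | _        = c , inj₁ (here refl)
  ... | no _     | yes refl = p , inj₂ (here refl)
  ... | no _     | no _     = Product.map₂ incident-there (incident-deg d)

  -- Edges (p , c) in the reverse of the order in which they were attached: c is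
  -- a leaf when (p , c) is the newest edge.
  data Forest : List (Edge N) → Set where
    []   : Forest []
    cons : ∀ {p c L} → p ≢ c → deg L c ≡ 0 → Forest L → Forest ((p , c) ∷ L)

  deg-newest : ∀ {p c L} → p ≢ c → deg L c ≡ 0 → deg ((p , c) ∷ L) c ≡ 1
  deg-newest {c = c} p≢c dc rewrite δ-≢ p≢c | δ-refl c | dc = refl

  forest-leaf : ∀ {e L} → Forest (e ∷ L) → ∃ λ v → deg (e ∷ L) v ≡ 1
  forest-leaf (cons {c = c} {L} p≢c dc _) = c , deg-newest {L = L} p≢c dc

  deg-split : ∀ {R B L} → Interleaving R B L → ∀ v → deg L v ≡ deg R v + deg B v
  deg-split []       v = refl
  deg-split {_ ∷ R} {B} {(p , c) ∷ L} (consˡ sp) v =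
    trans (cong (λ z → δ p v + (δ c v + z)) (deg-split sp v))
      (trans (cong (δ p v +_) (sym (+-assoc (δ c v) (deg R v) (deg B v)))) (sym (+-assoc (δ p v) _ _)))
  deg-split {R} {_ ∷ B} {(p , c) ∷ L} (consʳ sp) v =
    trans (cong (λ z → δ p v + (δ c v + z)) (deg-split sp v))
      (trans (cong (δ p v +_) (x∙yz≈y∙xz (δ c v) (deg R v) _)) (x∙yz≈y∙xz (δ p v) (deg R v) _))
    where open import Algebra.Properties.CommutativeSemigroup +-commutativeSemigroup

  degˡ-≤ : ∀ {R B L} → Interleaving R B L → ∀ v → deg R v ≤ deg L v
  degˡ-≤ sp v rewrite deg-split sp v = m≤m+n _ _

  degʳ-≤ : ∀ {R B L} → Interleaving R B L → ∀ v → deg B v ≤ deg L v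
  degʳ-≤ sp v rewrite deg-split sp v = m≤n+m _ _

  forestˡ : ∀ {R B L} → Interleaving R B L → Forest L → Forest R
  forestˡ [] [] = []
  forestˡ (consˡ sp) (cons p≢c dc F) = cons p≢c (n≤0⇒n≡0 (subst (_ ≤_) dc (degˡ-≤ sp _))) (forestˡ sp F)
  forestˡ (consʳ sp) (cons p≢c dc F) = forestˡ sp F

  forestʳ : ∀ {R B L} → Interleaving R B L → Forest L → Forest B
  forestʳ sp = forestˡ (swap sp)

  incidentˡ : ∀ {R B L} → Interleaving R B L → ∀ {u v} → Incident R u v → Incident L u v
  incidentˡ sp = Sum.map (memˡ sp) (memˡ sp)
    where
    memˡ : ∀ {R B L} → Interleaving R B L → ∀ {e} → e ∈ˡ R → e ∈ˡ L
    memˡ (consˡ sp) (here refl) = here refl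
    memˡ (consˡ sp) (there i)   = there (memˡ sp i)
    memˡ (consʳ sp) i           = there (memˡ sp i)

  incidentʳ : ∀ {R B L} → Interleaving R B L → ∀ {u v} → Incident B u v → Incident L u v
  incidentʳ sp = incidentˡ (swap sp)

  incident-split : ∀ {R B L} → Interleaving R B L → ∀ {u v} →
                   Incident L u v → Incident R u v ⊎ Incident B u v
  incident-split sp (inj₁ i) = Sum.map inj₁ inj₁ (mem sp i)
    where
    mem : ∀ {R B L} → Interleaving R B L → ∀ {e} → e ∈ˡ L → e ∈ˡ R ⊎ e ∈ˡ B
    mem (consˡ sp) (here refl) = inj₁ (here refl)
    mem (consʳ sp) (here refl) = inj₂ (here refl)
    mem (consˡ sp) (there i)   = Sum.map₁ there (mem sp i)
    mem (consʳ sp) (there i)   = Sum.map₂ there (mem sp i)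
  incident-split sp (inj₂ i) = Sum.swap
    (Sum.swap (Sum.map Incident-sym Incident-sym (incident-split sp (inj₁ i))))

  fresh-¬incident : ∀ {L u v} → deg L u ≡ 0 → ¬ Incident L u v
  fresh-¬incident du i with () ← subst (1 ≤_) du (deg-incident i)

  -- The child of the newest edge is isolated in the rest of the list, so no other entry joins the
  -- same two vertices, in either orientation.
  split-disjoint : ∀ {R B L} → Interleaving R B L → Forest L →
                   ∀ {u v} → Incident R u v → ¬ Incident B u v
  split-disjoint (consˡ sp) (cons p≢c dc F) (inj₁ (here refl)) j =
    fresh-¬incident (forest-fresh dc) (Incident-sym j)
    where forest-fresh = λ dc → n≤0⇒n≡0 (subst (_ ≤_) dc (degʳ-≤ sp _))
  split-disjoint (consˡ sp) (cons p≢c dc F) (inj₂ (here refl)) j =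
    fresh-¬incident (n≤0⇒n≡0 (subst (_ ≤_) dc (degʳ-≤ sp _))) j
  split-disjoint (consˡ sp) (cons p≢c dc F) (inj₁ (there i)) j = split-disjoint sp F (inj₁ i) j
  split-disjoint (consˡ sp) (cons p≢c dc F) (inj₂ (there i)) j = split-disjoint sp F (inj₂ i) j
  split-disjoint (consʳ sp) (cons p≢c dc F) i (inj₁ (here refl)) =
    fresh-¬incident (n≤0⇒n≡0 (subst (_ ≤_) dc (degˡ-≤ sp _))) (Incident-sym i)
  split-disjoint (consʳ sp) (cons p≢c dc F) i (inj₂ (here refl)) =
    fresh-¬incident (n≤0⇒n≡0 (subst (_ ≤_) dc (degˡ-≤ sp _))) i
  split-disjoint (consʳ sp) (cons p≢c dc F) i (inj₁ (there j)) = split-disjoint sp F i (inj₁ j)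
  split-disjoint (consʳ sp) (cons p≢c dc F) i (inj₂ (there j)) = split-disjoint sp F i (inj₂ j)

∣p∣≡1+∣p-x∣ : ∀ {N} {p : Subset N} {x} → x ∈ p → ∣ p ∣ ≡ suc ∣ p - x ∣
∣p∣≡1+∣p-x∣ {p = _ ∷ p} here = cong (suc ∘ ∣_∣) (sym (p─⊥≡p p))
∣p∣≡1+∣p-x∣ {p = inside  ∷ p} (there x∈p) = cong suc (∣p∣≡1+∣p-x∣ x∈p)
∣p∣≡1+∣p-x∣ {p = outside ∷ p} (there x∈p) = ∣p∣≡1+∣p-x∣ x∈p

x∉p-x : ∀ {N} (p : Subset N) x → x ∉ p - x
x∉p-x (_ ∷ p) zero    ()
x∉p-x (outside ∷ p) (suc x) (there i) = x∉p-x p x i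
x∉p-x (inside ∷ p) (suc x) (there i) = x∉p-x p x i

module _ {N : ℕ} where

  -- The set `S` is arbitrary because the induction deletes an end of the newest edge from it.
  -- Freshness of `c` excludes parallel edges, which `deg` would count twice and `S` only once.
  ∣neighbours∣≡deg : ∀ {L : List (Edge N)} → Forest L → ∀ {v} (S : Subset N) →
    (∀ {u} → u ∈ S → Incident L v u) → (∀ {u} → Incident L v u → u ∈ S) → ∣ S ∣ ≡ deg L v
  ∣neighbours∣≡deg [] {v} S f g =
    trans (cong ∣_∣ (Empty-unique {p = S} λ (u , u∈) → [ (λ ()) , (λ ()) ]′ (f u∈))) (∣⊥∣≡0 N)
  ∣neighbours∣≡deg (cons {p} {c} {L} p≢c dc F) {v} S f g with p ≟ᶠ v | c ≟ᶠ v
  ... | yes refl | yes refl = contradiction refl p≢c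
  ... | yes refl | no _     = trans (∣p∣≡1+∣p-x∣ (g (inj₁ (here refl))))
    (cong suc (∣neighbours∣≡deg F (S - c) f′ λ i → x∈p∧x≢y⇒x∈p-y (g (incident-there i))
      λ { refl → fresh-¬incident dc (Incident-sym {L = L} i) }))
    where
    f′ : ∀ {u} → u ∈ S - c → Incident L p u
    f′ u∈ with f (p─q⊆p S _ u∈)
    ... | inj₁ (here refl) = contradiction u∈ (x∉p-x S c)
    ... | inj₁ (there i)   = inj₁ i
    ... | inj₂ (here refl) = contradiction refl p≢c
    ... | inj₂ (there i)   = inj₂ i
  ... | no _     | yes refl = trans (∣p∣≡1+∣p-x∣ (g (inj₂ (here refl))))
    (cong suc (∣neighbours∣≡deg F (S - p) f′ λ i → contradiction i (fresh-¬incident dc)))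
    where
    f′ : ∀ {u} → u ∈ S - p → Incident L c u
    f′ u∈ with f (p─q⊆p S _ u∈)
    ... | inj₁ (here refl) = contradiction refl p≢c
    ... | inj₁ (there i)   = inj₁ i
    ... | inj₂ (here refl) = contradiction u∈ (x∉p-x S p)
    ... | inj₂ (there i)   = inj₂ i
  ... | no p≢v   | no c≢v   = ∣neighbours∣≡deg F S f′ (g ∘ incident-there)
    where
    f′ : ∀ {u} → u ∈ S → Incident L v u
    f′ u∈ with f u∈
    ... | inj₁ (here refl) = contradiction refl p≢v
    ... | inj₁ (there i)   = inj₁ i
    ... | inj₂ (here refl) = contradiction refl c≢v
    ... | inj₂ (there i)   = inj₂ i

-- The value 0 stands for the vertices outside the induced subgraph, the value 1 for its leaves.
Among : ℕ → ℕ → Set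
Among α x = x ≡ 0 ⊎ x ≡ 1 ⊎ x ≡ α

-- A vertex of degree d with at least r red and at least b blue edges can have
-- s red and d ∸ s blue edges.
OK : ℕ → ℕ → ℕ → ℕ → ℕ → Set
OK α β r b d = ∃ λ s → Among α s × Among β (d ∸ s) × r ≤ s × s + b ≤ d

-- Trees grown from the root and feasible partial colourings

module _ {n : ℕ} where

  root : Fin (suc n)
  root = zero

  Reached : List (Edge (suc n)) → Fin (suc n) → Set
  Reached []            v = v ≡ root
  Reached ((p , c) ∷ L) v = v ≡ c ⊎ Reached L v

  -- Stronger than `Forest`, since all edges hang together with the root. A colour class of a grown
  -- list is in general only a `Forest`.
  data Grown : List (Edge (suc n)) → Set where
    []   : Grown []
    cons : ∀ {p c L} → Reached L p → ¬ Reached L c → Grown L → Grown ((p , c) ∷ L)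

  reached-root : ∀ L → Reached L root
  reached-root []      = refl
  reached-root (e ∷ L) = inj₂ (reached-root L)

  reached? : ∀ L v → Dec (Reached L v)
  reached? []            v = v ≟ᶠ root
  reached? ((p , c) ∷ L) v = v ≟ᶠ c ⊎-dec reached? L v

  reached-≢ : ∀ {L u v} → Reached L u → ¬ Reached L v → u ≢ v
  reached-≢ ru ¬rv refl = ¬rv ru

  unreached-deg : ∀ {L v} → Grown L → ¬ Reached L v → deg L v ≡ 0
  unreached-deg [] _ = refl
  unreached-deg {(p , c) ∷ L} {v} (cons rp _ G) ¬rv
    rewrite δ-≢ {u = p} {v} (reached-≢ {L} rp (¬rv ∘ inj₂)) | δ-≢ {u = c} {v} (λ c≡v → ¬rv (inj₁ (sym c≡v)))
    = unreached-deg G (¬rv ∘ inj₂)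

  grown⇒forest : ∀ {L} → Grown L → Forest L
  grown⇒forest [] = []
  grown⇒forest (cons {L = L} rp ¬rc G) = cons (reached-≢ {L} rp ¬rc) (unreached-deg G ¬rc) (grown⇒forest G)

  module _ (α β : ℕ) (d : Fin (suc n) → ℕ) where

    -- r and b count the edges at each vertex that are no longer in L and whose
    -- colour was forced to be red or blue.
    Feasible : List (Edge (suc n)) → (Fin (suc n) → ℕ) → (Fin (suc n) → ℕ) → Set
    Feasible L r b = ∃₂ λ R B → Interleaving R B L ×
      (∀ v → Reached L v → OK α β (r v + deg R v) (b v + deg B v) (d v))

    ok-mono : ∀ {r r′ b b′ d} → r′ ≤ r → b′ ≤ b → OK α β r b d → OK α β r′ b′ d
    ok-mono r≤ b≤ (s , A , A′ , r≤s , s+b≤d) =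
      s , A , A′ , ≤-trans r≤ r≤s , ≤-trans (+-monoʳ-≤ s b≤) s+b≤d

    -- The witness `s` lies between `r` and `d ∸ b`, and these bounds differ by assumption. If `s`
    -- is not the lower bound, one more edge may be red; otherwise it is not the upper bound, and
    -- one more may be blue.
    ok-free : ∀ {r b d} → r + b < d → OK α β r b d → OK α β (suc r) b d ⊎ OK α β r (suc b) d
    ok-free {r} {b} {e} r+b<d (s , A , A′ , r≤s , s+b≤d) with m≤n⇒m<n∨m≡n r≤s
    ... | inj₁ r<s  = inj₁ (s , A , A′ , r<s , s+b≤d)
    ... | inj₂ refl = inj₂ (s , A , A′ , r≤s , subst (_≤ e) (sym (+-suc s b)) r+b<d)

    feasible-mono : ∀ {L r r′ b b′} → (∀ v → Reached L v → r′ v ≤ r v) → (∀ v → Reached L v → b′ v ≤ b v) →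
                    Feasible L r b → Feasible L r′ b′
    feasible-mono r≤ b≤ (R , B , sp , ok) = R , B , sp , λ v rv →
      ok-mono (+-monoˡ-≤ _ (r≤ v rv)) (+-monoˡ-≤ _ (b≤ v rv)) (ok v rv)

    -- A removed edge whose colour was not forced is counted neither in r nor in b.
    -- It leaves a gap at p, so whichever colouring of L is chosen there is a
    -- colour left for it.
    feasible-free : ∀ {L r b p} → r p + b p + deg L p < d p → Feasible L r b →
      Feasible L (λ v → δ p v + r v) b ⊎ Feasible L r (λ v → δ p v + b v)
    feasible-free {L} {r} {b} {p} free (R , B , sp , ok) with reached? L p
    ... | no ¬rp = inj₁ (R , B , sp , λ v rv →
      subst (λ z → OK α β (z + r v + deg R v) (b v + deg B v) (d v))
        (sym (δ-≢ (reached-≢ {L} rv ¬rp ∘ sym))) (ok v rv))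
    ... | yes rp with ok-free (subst (_< d p) eq free) (ok p rp)
      where
      open import Algebra.Properties.CommutativeSemigroup +-commutativeSemigroup
      eq : r p + b p + deg L p ≡ (r p + deg R p) + (b p + deg B p)
      eq = trans (cong (r p + b p +_) (deg-split sp p)) (interchange (r p) (b p) (deg R p) (deg B p))
    ... | inj₁ okp = inj₁ (R , B , sp , ok′)
      where
      ok′ : ∀ v → Reached L v → OK α β (δ p v + r v + deg R v) (b v + deg B v) (d v)
      ok′ v rv with p ≟ᶠ v
      ... | yes refl = okp
      ... | no _     = ok v rv
    ... | inj₂ okp = inj₂ (R , B , sp , ok′)
      where
      ok′ : ∀ v → Reached L v → OK α β (r v + deg R v) (δ p v + b v + deg B v) (d v)
      ok′ v rv with p ≟ᶠ v
      ... | yes refl = okp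
      ... | no _     = ok v rv

    module _ {p c : Fin (suc n)} {L : List (Edge (suc n))} (rp : Reached L p) (¬rc : ¬ Reached L c)
      (G : Grown L)
             {r b : Fin (suc n) → ℕ} where

      private
        p≢c = reached-≢ {L} rp ¬rc
        dc  = unreached-deg G ¬rc

        at-c-new : ∀ {K} → deg K c ≡ 0 → ∀ x → x + deg ((p , c) ∷ K) c ≡ suc x
        at-c-new {K} dKc x = trans (cong (x +_) (deg-newest {L = K} p≢c dKc)) (+-comm x 1)

        at-c-old : ∀ {K} → deg K c ≡ 0 → ∀ x → x + deg K c ≡ x
        at-c-old dKc x = trans (cong (x +_) dKc) (+-identityʳ x)

        elsewhere : ∀ {K v} x → c ≢ v → x + deg ((p , c) ∷ K) v ≡ δ p v + x + deg K v
        elsewhere {K} {v} x c≢v = trans (cong (λ z → x + (δ p v + (z + deg K v))) (δ-≢ c≢v))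
          (trans (sym (+-assoc x _ _)) (cong (_+ deg K v) (+-comm x (δ p v))))

        freshˡ : ∀ {R B} → Interleaving R B L → deg R c ≡ 0
        freshˡ sp = n≤0⇒n≡0 (subst (_ ≤_) dc (degˡ-≤ sp c))

        freshʳ : ∀ {R B} → Interleaving R B L → deg B c ≡ 0
        freshʳ sp = freshˡ (swap sp)

      -- The newest edge is the only listed one at `c`, so the condition at `c` becomes a test of
      -- its counters alone. At `p` the edge merely moves from the list to a counter.
      feasible-uncons : Feasible ((p , c) ∷ L) r b →
        (OK α β (suc (r c)) (b c) (d c) × Feasible L (λ v → δ p v + r v) b) ⊎
        (OK α β (r c) (suc (b c)) (d c) × Feasible L r (λ v → δ p v + b v))
      feasible-uncons (_ ∷ R , B , consˡ sp , ok) = inj₁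
        (subst₂ (λ x y → OK α β x y (d c)) (at-c-new {R} (freshˡ sp) (r c))
          (at-c-old {B} (freshʳ sp) (b c)) (ok c (inj₁ refl)) ,
         R , B , sp , λ v rv → subst (λ x → OK α β x (b v + deg B v) (d v))
           (elsewhere {R} (r v) (reached-≢ {L} rv ¬rc ∘ sym)) (ok v (inj₂ rv)))
      feasible-uncons (R , _ ∷ B , consʳ sp , ok) = inj₂
        (subst₂ (λ x y → OK α β x y (d c)) (at-c-old {R} (freshˡ sp) (r c))
          (at-c-new {B} (freshʳ sp) (b c)) (ok c (inj₁ refl)) ,
         R , B , sp , λ v rv → subst (λ y → OK α β (r v + deg R v) y (d v))
           (elsewhere {B} (b v) (reached-≢ {L} rv ¬rc ∘ sym)) (ok v (inj₂ rv)))

      feasible-red : OK α β (suc (r c)) (b c) (d c) → Feasible L (λ v → δ p v + r v) b →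
        Feasible ((p , c) ∷ L) r b
      feasible-red okc (R , B , sp , ok) = (p , c) ∷ R , B , consˡ sp , λ where
        v (inj₁ refl) → subst₂ (λ x y → OK α β x y (d c))
          (sym (at-c-new {R} (freshˡ sp) (r c))) (sym (at-c-old {B} (freshʳ sp) (b c))) okc
        v (inj₂ rv) → subst (λ x → OK α β x (b v + deg B v) (d v))
           (sym (elsewhere {R} (r v) (reached-≢ {L} rv ¬rc ∘ sym))) (ok v rv)

      feasible-blue : OK α β (r c) (suc (b c)) (d c) → Feasible L r (λ v → δ p v + b v) →
        Feasible ((p , c) ∷ L) r b
      feasible-blue okc (R , B , sp , ok) = R , (p , c) ∷ B , consʳ sp , λ where
        v (inj₁ refl) → subst₂ (λ x y → OK α β x y (d c))
          (sym (at-c-old {R} (freshˡ sp) (r c))) (sym (at-c-new {B} (freshʳ sp) (b c))) okc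
        v (inj₂ rv) → subst (λ y → OK α β (r v + deg R v) y (d v))
           (sym (elsewhere {B} (b v) (reached-≢ {L} rv ¬rc ∘ sym))) (ok v rv)

      feasible-neither : ¬ OK α β (suc (r c)) (b c) (d c) → ¬ OK α β (r c) (suc (b c)) (d c) →
                         ¬ Feasible ((p , c) ∷ L) r b
      feasible-neither ¬red ¬blue = [ ¬red ∘ proj₁ , ¬blue ∘ proj₁ ]′ ∘ feasible-uncons

      feasible-only-red : OK α β (suc (r c)) (b c) (d c) → ¬ OK α β (r c) (suc (b c)) (d c) →
        Feasible ((p , c) ∷ L) r b ⇔ Feasible L (λ v → δ p v + r v) b
      feasible-only-red red ¬blue = mk⇔
        ([ proj₂ , (λ z → contradiction (proj₁ z) ¬blue) ]′ ∘ feasible-uncons) (feasible-red red)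

      feasible-only-blue : ¬ OK α β (suc (r c)) (b c) (d c) → OK α β (r c) (suc (b c)) (d c) →
        Feasible ((p , c) ∷ L) r b ⇔ Feasible L r (λ v → δ p v + b v)
      feasible-only-blue ¬red blue = mk⇔
        ([ (λ z → contradiction (proj₁ z) ¬red) , proj₂ ]′ ∘ feasible-uncons) (feasible-blue blue)

      feasible-either : OK α β (suc (r c)) (b c) (d c) → OK α β (r c) (suc (b c)) (d c) →
        r p + b p + deg L p < d p → Feasible ((p , c) ∷ L) r b ⇔ Feasible L r b
      feasible-either red blue free = mk⇔
        ([ feasible-mono (λ v _ → m≤n+m (r v) (δ p v)) (λ _ _ → ≤-refl) ∘ proj₂
         , feasible-mono (λ _ _ → ≤-refl) (λ v _ → m≤n+m (b v) (δ p v)) ∘ proj₂ ]′ ∘ feasible-uncons)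
        ([ feasible-red red , feasible-blue blue ]′ ∘ feasible-free free)

-- Decidable vertex sets and incidence

∈tabulate⁺ : ∀ {N} {P : Fin N → Set} (P? : ∀ v → Dec (P v)) {v} → P v → v ∈ tabulate (does ∘ P?)
∈tabulate⁺ P? {v} Pv = lookup⇒[]= v _ (trans (lookup∘tabulate _ v) (dec-true (P? v) Pv))

∈tabulate⁻ : ∀ {N} {P : Fin N → Set} (P? : ∀ v → Dec (P v)) {v} → v ∈ tabulate (does ∘ P?) → P v
∈tabulate⁻ P? {v} v∈ with P? v | trans (sym (lookup∘tabulate (does ∘ P?) v)) ([]=⇒lookup v∈)
... | yes Pv | _ = Pv
... | no _   | ()

_≟ᵉ_ : ∀ {N} (e f : Edge N) → Dec (e ≡ f)
_≟ᵉ_ = ≡-dec _≟ᶠ_ _≟ᶠ_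

incident? : ∀ {N} (L : List (Edge N)) u v → Dec (Incident L u v)
incident? L u v = (u , v) ∈ˡ? L ⊎-dec (v , u) ∈ˡ? L
  where open DecMembership _≟ᵉ_ renaming (_∈?_ to _∈ˡ?_)

-- Simple paths

module _ {N : ℕ} where

  data SimplePath (R : Fin N → Fin N → Set) : Fin N → List (Fin N) → Fin N → Set where
    []   : ∀ {v} → SimplePath R v [] v
    cons : ∀ {u x v xs} → R u x → ¬ u ∈ˡ x ∷ xs → SimplePath R x xs v → SimplePath R u (x ∷ xs) v

  module _ {R : Fin N → Fin N → Set} where

    shortcut : ∀ {u x v xs} → SimplePath R x xs v → u ∈ˡ x ∷ xs → ∃ λ ys → SimplePath R u ys v
    shortcut P             (here refl) = _ , P
    shortcut (cons _ _ P)  (there i)   = shortcut P i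

    eraseLoops : ∀ {u v} → Star R u v → ∃ λ xs → SimplePath R u xs v
    eraseLoops ε = [] , []
    eraseLoops {u} (_◅_ {j = x} Rux W) with eraseLoops W
    ... | xs , P with DecMembership._∈?_ _≟ᶠ_ u (x ∷ xs)
    ...   | yes i = shortcut P i
    ...   | no ¬i = x ∷ xs , cons Rux ¬i P

    simplePath-unique : ∀ {u v xs} → SimplePath R u xs v → Unique (u ∷ xs)
    simplePath-unique []            = [] ∷ []
    simplePath-unique (cons _ u∉ P) = ¬Any⇒All¬ _ u∉ ∷ simplePath-unique P

    simplePath-linked : ∀ {S : Fin N → Fin N → Set} → (∀ {x y} → R x y → S x y) →
      ∀ {u v w xs} → SimplePath R u xs v → S v w → Linked S (u ∷ xs ++ [ w ])
    simplePath-linked R⇒S []                       Svw = Svw ∷ [-]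
    simplePath-linked R⇒S (cons Rux _ [])          Svw = R⇒S Rux ∷ Svw ∷ [-]
    simplePath-linked R⇒S (cons Rux _ P@(cons _ _ _)) Svw = R⇒S Rux ∷ simplePath-linked R⇒S P Svw

module _ {n : ℕ} where

  reached⇒walk : ∀ {L : List (Edge (suc n))} → Grown L → ∀ {v} → Reached L v → Star (Incident L) v root
  reached⇒walk [] refl = ε
  reached⇒walk (cons rp ¬rc G) (inj₁ refl) = inj₂ (here refl) ◅ gmap id incident-there (reached⇒walk G rp)
  reached⇒walk (cons rp ¬rc G) (inj₂ r)    = gmap id incident-there (reached⇒walk G r)
  module _ (T : Graph (suc n)) where

    -- An edge outside L would close a cycle with the path that joins its ends in L.
    acyclic⇒⊆ : ∀ {L} → Acyclic T → Grown L → (∀ {u v} → Incident L u v → Adjacent T u v) →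
                (∀ v → Reached L v) → ∀ {u v} → Adjacent T u v → Incident L u v
    acyclic⇒⊆ {L} acyc G L⊆T all {u} {v} uv with incident? L u v
    ... | yes i = i
    ... | no ¬i with eraseLoops (reached⇒walk G (all u) ◅◅ reverse (Incident-sym {L = L})
      (reached⇒walk G (all v)))
    -- A path of length 0 would make `uv` a loop and one of length 1 would put it into `L`, so the
    -- path has the further vertices that `IsCycle` demands.
    ...   | []             , []                  = contradiction uv (Graph.irreflexive T)
    ...   | x ∷ []         , cons ux _ []        = contradiction ux ¬i
    ...   | xs@(_ ∷ _ ∷ _) , P =
      contradiction (s≤s (s≤s z≤n) , simplePath-unique P , simplePath-linked L⊆T P
        (Graph.symmetric T uv)) (acyc u xs)

  -- The root and the children of the edges are `suc (length L)` distinct vertices. This bounds the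
  -- number of times an edge can be attached.
  grown-length : ∀ {L : List (Edge (suc n))} → Grown L → length L ≤ n
  grown-length {L} G = s≤s⁻¹ (injective⇒≤ {f = child G} (child-injective G))
    where
    child : ∀ {L} → Grown L → Fin (suc (length L)) → Fin (suc n)
    child []                     i       = root
    child (cons {c = c} _ _ G) zero    = c
    child (cons _ _ G)         (suc i) = child G i
    child-reached : ∀ {L} (G : Grown L) i → Reached L (child G i)
    child-reached []                   i       = refl
    child-reached (cons _ _ G) zero    = inj₁ refl
    child-reached (cons _ _ G) (suc i) = inj₂ (child-reached G i)
    child-injective : ∀ {L} (G : Grown L) {i j} → child G i ≡ child G j → i ≡ j
    child-injective [] {zero} {zero} _ = refl
    child-injective (cons _ ¬rc G) {zero}  {zero}  _  = refl
    child-injective (cons _ ¬rc G) {zero}  {suc j} eq = contradiction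
      (subst (Reached _) (sym eq) (child-reached G j)) ¬rc
    child-injective (cons _ ¬rc G) {suc i} {zero}  eq = contradiction
      (subst (Reached _) eq (child-reached G i)) ¬rc
    child-injective (cons _ ¬rc G) {suc i} {suc j} eq = cong suc (child-injective G eq)

parent-unique : ∀ {N} {L : List (Edge N)} → Forest L → ∀ {p q c} → (p , c) ∈ˡ L → (q , c) ∈ˡ L → p ≡ q
parent-unique (cons _ dc F) (here refl) (here refl) = refl
parent-unique (cons _ dc F) (here refl) (there j)   = contradiction (inj₂ j) (fresh-¬incident dc)
parent-unique (cons _ dc F) (there i)   (here refl) = contradiction (inj₂ i) (fresh-¬incident dc)
parent-unique (cons _ dc F) (there i)   (there j)   = parent-unique F i j

allPairs-lookup : ∀ {A : Set} {R : A → A → Set} {xs} → AllPairs R xs → ∀ {i j} → i <ᶠ j →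
  R (lookup xs i) (lookup xs j)
allPairs-lookup (Rx ∷ _)   {zero}  {suc j} _         = All.lookup Rx (∈-lookup j)
allPairs-lookup (_ ∷ Rxs) {suc i} {suc j} (s≤s i<j) = allPairs-lookup Rxs i<j

-- Send every listed edge to its end away from the root.
forest-edges≤ : ∀ {N} {L es : List (Edge N)} → Forest L → AllPairs (λ e f → e ≢ f × e ≢ Product.swap f) es →
                (∀ {u v} → (u , v) ∈ˡ es → Incident L u v) → length es ≤ N
forest-edges≤ {N} {L} {es} F distinct ⊆L = injective⇒≤ {f = proj₁ ∘ child} child-injective
  where
  Child : Fin (length es) → Set
  Child i = ∃₂ λ c p → (p , c) ∈ˡ L × (lookup es i ≡ (p , c) ⊎ lookup es i ≡ (c , p))
  child : ∀ i → Child i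
  child i with ⊆L (∈-lookup i)
  ... | inj₁ k = _ , _ , k , inj₁ refl
  ... | inj₂ k = _ , _ , k , inj₂ refl
  -- Equal children have equal parents, so two such entries would be the same edge up to
  -- orientation.
  clash : ∀ {i j} → i <ᶠ j → (x : Child i) (y : Child j) → proj₁ x ≢ proj₁ y
  clash i<j (c , p , k , a) (.c , q , l , b) refl with refl ← parent-unique F k l
    with a | b | allPairs-lookup distinct i<j
  ... | inj₁ x | inj₁ y | e≢f , _ = e≢f (trans x (sym y))
  ... | inj₁ x | inj₂ y | _ , e≢f = e≢f (trans x (sym (cong Product.swap y)))
  ... | inj₂ x | inj₁ y | _ , e≢f = e≢f (trans x (sym (cong Product.swap y)))
  ... | inj₂ x | inj₂ y | e≢f , _ = e≢f (trans x (sym y))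
  child-injective : ∀ {i j} → proj₁ (child i) ≡ proj₁ (child j) → i ≡ j
  child-injective {i} {j} eq with <ᶠ-cmp i j
  ... | tri< i<j _ _ = contradiction eq (clash i<j (child i) (child j))
  ... | tri≈ _ i≡j _ = i≡j
  ... | tri> _ _ j<i = contradiction (sym eq) (clash j<i (child j) (child i))

-- Weakly semiregular partitions in terms of the degrees of the colour classes

Semi : ∀ {N} → ℕ → (Fin N → ℕ) → Set
Semi α f = ∀ v → Among α (f v)

among? : ∀ α x → Dec (Among α x)
among? α x = x ≟ 0 ⊎-dec x ≟ 1 ⊎-dec x ≟ α

-- A value above the bound is never attained and may be replaced by 0. This leaves finitely many
-- values of `α` to search.
semi-bounded : ∀ {N} {f : Fin N → ℕ} {α} K → (∀ v → f v ≤ K) → Semi α f → ∃ λ α′ → α′ ≤ K × Semi α′ f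
semi-bounded {α = α} K f≤K S with α ≤? K
... | yes α≤K = α , α≤K , S
... | no α≰K  = 0 , z≤n , λ v → case S v of λ where
  (inj₁ x)        → inj₁ x
  (inj₂ (inj₁ x)) → inj₂ (inj₁ x)
  (inj₂ (inj₂ x)) → contradiction (subst (_≤ K) x (f≤K v)) α≰K

semi? : ∀ {N} (f : Fin N → ℕ) K → (∀ v → f v ≤ K) → Dec (∃ λ α → Semi α f)
semi? f K f≤K = map′ (λ (α , S) → toℕ α , S)
  (λ (α , S) → let α′ , α′≤K , S′ = semi-bounded K f≤K S in
               fromℕ< (s≤s α′≤K) , subst (λ z → Semi z f) (sym (toℕ-fromℕ< (s≤s α′≤K))) S′)
  (any? {n = suc K} λ α → all? λ v → among? (toℕ α) (f v))

Spans : ∀ {N} → Graph N → List (Edge N) → Set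
Spans T L = Forest L × (∀ {u v} → Incident L u v → Adjacent T u v) ×
  (∀ {u v} → Adjacent T u v → Incident L u v)

interleaving-[]ˡ : ∀ {A : Set} {B L : List A} → Interleaving [] B L → B ≡ L
interleaving-[]ˡ []        = refl
interleaving-[]ˡ (consʳ sp) = cong (_ ∷_) (interleaving-[]ˡ sp)

module _ {N : ℕ} {T : Graph N} where

  ∣ends∣≡deg : ∀ {R} → Forest R → (E : EdgeSet T) → (∀ {u v} → v ∈ ends E u → Incident R u v) →
               (∀ {u v} → Incident R u v → v ∈ ends E u) → ∀ v → ∣ ends E v ∣ ≡ deg R v
  ∣ends∣≡deg F E E⇒R R⇒E v = ∣neighbours∣≡deg F (ends E v) E⇒R R⇒E

  weaklySemiregular⇒semi : ∀ {R} → Forest R → (E : EdgeSet T) → (∀ {u v} → v ∈ ends E u → Incident R u v) →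
    (∀ {u v} → Incident R u v → v ∈ ends E u) → WeaklySemiregular (induced E) → ∃ λ α → Semi α (deg R)
  weaklySemiregular⇒semi {[]}    F E E⇒R R⇒E _           = 0 , λ _ → inj₁ refl
  weaklySemiregular⇒semi {e ∷ R} F E E⇒R R⇒E (a , b , S) = choose (degrees l (≤-reflexive (sym dl)))
    where
    degrees : ∀ v → 1 ≤ deg (e ∷ R) v → deg (e ∷ R) v ≡ a ⊎ deg (e ∷ R) v ≡ b
    degrees v 1≤d = subst (λ z → z ≡ a ⊎ z ≡ b) (∣ends∣≡deg F E E⇒R R⇒E v)
      (S (∈endpoints E (R⇒E (proj₂ (incident-deg {L = e ∷ R} 1≤d)))))
    l = proj₁ (forest-leaf F)
    dl = proj₂ (forest-leaf F)
    choose : deg (e ∷ R) l ≡ a ⊎ deg (e ∷ R) l ≡ b → ∃ λ α → Semi α (deg (e ∷ R))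
    choose (inj₁ l≡a) = b , λ v → case deg (e ∷ R) v ≟ 0 of λ where
      (yes d≡0) → inj₁ d≡0
      (no d≢0)  → inj₂ (Sum.map₁ (λ d≡a → trans d≡a (trans (sym l≡a) dl)) (degrees v (n≢0⇒n>0 d≢0)))
    choose (inj₂ l≡b) = a , λ v → case deg (e ∷ R) v ≟ 0 of λ where
      (yes d≡0) → inj₁ d≡0
      (no d≢0)  → inj₂ (Sum.swap (Sum.map₂ (λ d≡b → trans d≡b (trans (sym l≡b) dl))
        (degrees v (n≢0⇒n>0 d≢0))))

  links : List (Edge N) → Fin N → Subset N
  links R u = tabulate (does ∘ incident? R u)

  links⁺ : ∀ R u {v} → Incident R u v → v ∈ links R u
  links⁺ R u = ∈tabulate⁺ (incident? R u)

  links⁻ : ∀ R u {v} → v ∈ links R u → Incident R u v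
  links⁻ R u = ∈tabulate⁻ (incident? R u)

  fromList : (R : List (Edge N)) → (∀ {u v} → Incident R u v → Adjacent T u v) → EdgeSet T
  fromList R R⊆T = record
    { ends      = links R
    ; symmetric = λ {u} {v} v∈ → links⁺ R v (Incident-sym {L = R} (links⁻ R u v∈))
    ; ⊆edges    = λ {u} v∈ → R⊆T (links⁻ R u v∈)
    }

  ∣links∣≡deg : ∀ {R} → Forest R → ∀ v → ∣ links R v ∣ ≡ deg R v
  ∣links∣≡deg {R} F v = ∣neighbours∣≡deg F (links R v) (links⁻ R v) (links⁺ R v)

  semi⇒weaklySemiregular : ∀ R (R⊆T : ∀ {u v} → Incident R u v → Adjacent T u v) {α} → Forest R →
    Semi α (deg R) → WeaklySemiregular (induced (fromList R R⊆T))
  semi⇒weaklySemiregular R R⊆T {α} F S = 1 , α , λ {v} v∈ →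
      let u , u∈ = ∈tabulate⁻ (λ w → nonempty? (links R w)) v∈
          1≤d    = deg-incident {L = R} (links⁻ R v u∈)
      in subst (λ z → z ≡ 1 ⊎ z ≡ α) (sym (∣links∣≡deg F v))
           (case S v of λ where
             (inj₁ d≡0) → contradiction d≡0 (>⇒≢ 1≤d)
             (inj₂ d≡)  → d≡)

  deg≤N : ∀ {L} → Spans T L → ∀ v → deg L v ≤ N
  deg≤N {L} (F , L⊆T , T⊆L) v = subst (_≤ N) (∣links∣≡deg F v) (∣p∣≤n (links L v))

  module _ {e : Edge N} {L : List (Edge N)} (span : Spans T (e ∷ L)) where

    private
      e∈T : Adjacent T (proj₁ e) (proj₂ e)
      e∈T = proj₁ (proj₂ span) (inj₁ (here refl))

    parts≢0 : ∀ {j} → WeaklySemiregularPartition T j → 1 ≤ j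
    parts≢0 {zero}  (P , _) with () ← proj₁ (EdgePartition.covering P e∈T)
    parts≢0 {suc j} _ = s≤s z≤n

    part1⇒semi : WeaklySemiregularPartition T 1 → ∃ λ α → Semi α (deg (e ∷ L))
    part1⇒semi (P , W) = weaklySemiregular⇒semi (proj₁ span) (part P zero)
      (proj₂ (proj₂ span) ∘ EdgeSet.⊆edges (part P zero)) (covered ∘ proj₁ (proj₂ span)) (W zero)
      where
      covered : ∀ {u v} → Adjacent T u v → v ∈ ends (part P zero) u
      covered a with EdgePartition.covering P a
      ... | zero , v∈ = v∈

    semi⇒part1 : ∀ {α} → Semi α (deg (e ∷ L)) → WeaklySemiregularPartition T 1
    semi⇒part1 S = record
      { part     = λ _ → fromList (e ∷ L) (proj₁ (proj₂ span))
      ; nonempty = λ _ → proj₁ e , _ , links⁺ (e ∷ L) (proj₁ e) (inj₁ (here refl))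
      ; covering = λ {u} a → zero , links⁺ (e ∷ L) u (proj₂ (proj₂ span) a)
      ; disjoint = λ { {zero} {zero} _ _ → refl }
      } , λ _ → semi⇒weaklySemiregular (e ∷ L) (proj₁ (proj₂ span)) (proj₁ span) S

    semi⇒part2 : ∀ {r R b B α β} → Interleaving (r ∷ R) (b ∷ B) (e ∷ L) →
                 Semi α (deg (r ∷ R)) → Semi β (deg (b ∷ B)) → WeaklySemiregularPartition T 2
    semi⇒part2 {r} {R} {b} {B} sp Sr Sb = record
      { part     = parts
      ; nonempty = λ { zero → proj₁ r , _ , links⁺ (r ∷ R) (proj₁ r) (inj₁ (here refl))
                     ; (suc zero) → proj₁ b , _ , links⁺ (b ∷ B) (proj₁ b) (inj₁ (here refl)) }
      ; covering = λ {u} a → [ (λ i → zero , links⁺ (r ∷ R) u i) , (λ i → suc zero , links⁺ (b ∷ B) u i) ]′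
                           (incident-split sp (proj₂ (proj₂ span) a))
      ; disjoint = disj
      } , λ { zero → semi⇒weaklySemiregular (r ∷ R) (proj₁ (proj₂ span) ∘ incidentˡ sp)
        (forestˡ sp (proj₁ span)) Sr
            ; (suc zero) → semi⇒weaklySemiregular (b ∷ B) (proj₁ (proj₂ span) ∘ incidentʳ sp)
              (forestʳ sp (proj₁ span)) Sb }
      where
      parts : Fin 2 → EdgeSet T
      parts zero       = fromList (r ∷ R) (proj₁ (proj₂ span) ∘ incidentˡ sp)
      parts (suc zero) = fromList (b ∷ B) (proj₁ (proj₂ span) ∘ incidentʳ sp)
      disj : ∀ {i j u v} → v ∈ ends (parts i) u → v ∈ ends (parts j) u → i ≡ j
      disj {zero}     {zero}     _ _ = refl
      disj {suc zero} {suc zero} _ _ = refl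
      disj {zero}     {suc zero} {u} x y =
        contradiction (links⁻ (b ∷ B) u y) (split-disjoint sp (proj₁ span) (links⁻ (r ∷ R) u x))
      disj {suc zero} {zero}     {u} x y =
        contradiction (links⁻ (b ∷ B) u x) (split-disjoint sp (proj₁ span) (links⁻ (r ∷ R) u y))

  -- Since `wr≤` refers to the least number of parts and parts are nonempty, while a colour may be
  -- empty, it has to be decided whether 0, 1 or 2 is the minimum. If one part does not suffice,
  -- neither colour is empty and the split is a partition into two parts.
  split⇒wr≤2 : ∀ {L R B α β} → Spans T L → Interleaving R B L → Semi α (deg R) → Semi β (deg B) → wr≤ T 2
  split⇒wr≤2 {[]} (_ , _ , T⊆L) _ _ _ = 0 ,
    ((record { part = λ (); nonempty = λ (); covering = λ a → case T⊆L a of λ { (inj₁ ()) ; (inj₂ ()) }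
             ; disjoint = λ { {()} } } , λ ()) , λ _ _ → z≤n) , z≤n
  split⇒wr≤2 {e ∷ L} {R} {B} span sp SR SB with semi? (deg (e ∷ L)) N (deg≤N span)
  ... | yes (α , S) = 1 , (semi⇒part1 span S , λ _ → parts≢0 span) , s≤s z≤n
  split⇒wr≤2 {e ∷ L} {[]}    {B}     span sp SR SB | no ¬S with refl ← interleaving-[]ˡ sp = contradiction (_ , SB) ¬S
  split⇒wr≤2 {e ∷ L} {_ ∷ _} {[]}    span sp SR SB | no ¬S with refl ← interleaving-[]ˡ
    (swap sp) = contradiction (_ , SR) ¬S
  split⇒wr≤2 {e ∷ L} {_ ∷ _} {_ ∷ _} span sp SR SB | no ¬S = 2 , (semi⇒part2 span sp SR SB , least) , ≤-refl
    where
    least : ∀ j → WeaklySemiregularPartition T j → 2 ≤ j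
    least zero          P = contradiction (parts≢0 span P) λ ()
    least (suc zero)    P = contradiction (part1⇒semi span P) ¬S
    least (suc (suc j)) P = s≤s (s≤s z≤n)

  -- Classes may be empty here, so that partitions into 0, 1 and 2 parts can be treated alike.
  record TwoParts : Set where
    field
      red blue : EdgeSet T
      red-ws   : WeaklySemiregular (induced red)
      blue-ws  : WeaklySemiregular (induced blue)
      covering : ∀ {u v} → Adjacent T u v → v ∈ ends red u ⊎ v ∈ ends blue u
      disjoint : ∀ {u v} → v ∈ ends red u → ¬ v ∈ ends blue u

  empty : EdgeSet T
  empty = fromList [] λ { (inj₁ ()) ; (inj₂ ()) }

  ∉empty : ∀ u {v} → ¬ v ∈ ends empty u
  ∉empty u v∈ with links⁻ [] u v∈
  ... | inj₁ ()
  ... | inj₂ ()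

  empty-ws : WeaklySemiregular (induced empty)
  empty-ws = semi⇒weaklySemiregular [] (λ { (inj₁ ()) ; (inj₂ ()) }) {0} [] λ _ → inj₁ refl

  twoParts : ∀ {m} → m ≤ 2 → WeaklySemiregularPartition T m → TwoParts
  twoParts {0} _ (P , W) = record
    { red = empty ; blue = empty ; red-ws = empty-ws ; blue-ws = empty-ws
    ; covering = λ a → case EdgePartition.covering P a of λ ()
    ; disjoint = λ {u} x → contradiction x (∉empty u) }
  twoParts {1} _ (P , W) = record
    { red = part P zero ; blue = empty ; red-ws = W zero ; blue-ws = empty-ws
    ; covering = λ a → case EdgePartition.covering P a of λ { (zero , v∈) → inj₁ v∈ }
    ; disjoint = λ {u} _ → ∉empty u }
  twoParts {2} _ (P , W) = record
    { red = part P zero ; blue = part P (suc zero) ; red-ws = W zero ; blue-ws = W (suc zero)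
    ; covering = λ a → case EdgePartition.covering P a of
      λ { (zero , v∈) → inj₁ v∈ ; (suc zero , v∈) → inj₂ v∈ }
    ; disjoint = λ x y → case EdgePartition.disjoint P x y of λ () }
  twoParts {suc (suc (suc _))} (s≤s (s≤s ())) _

  splitBy : (E : EdgeSet T) (L : List (Edge N)) → ∃₂ λ R B → Interleaving R B L ×
            (∀ {u v} → (u , v) ∈ˡ R → v ∈ ends E u) × (∀ {u v} → (u , v) ∈ˡ B → ¬ v ∈ ends E u)
  splitBy E [] = [] , [] , [] , (λ ()) , λ ()
  splitBy E ((p , c) ∷ L) with c ∈? ends E p | splitBy E L
  ... | yes c∈ | R , B , sp , f , g = (p , c) ∷ R , B , consˡ sp ,
    (λ { (here refl) → c∈ ; (there i) → f i }) , g
  ... | no c∉  | R , B , sp , f , g = R , (p , c) ∷ B , consʳ sp , f ,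
    λ { (here refl) → c∉ ; (there i) → g i }

  wr≤2⇒split : ∀ {L} → Spans T L → wr≤ T 2 →
    ∃₂ λ R B → Interleaving R B L × (∃ λ α → Semi α (deg R)) × (∃ λ β → Semi β (deg B))
  wr≤2⇒split {L} (F , L⊆T , T⊆L) (m , (P , _) , m≤2) with twoParts m≤2 P
  ... | record { red = E ; blue = E′ ; red-ws = W ; blue-ws = W′ ; covering = cov ; disjoint = dis } with splitBy E L
  ...   | R , B , sp , R⇒E , B⇒¬E = R , B , sp
    , weaklySemiregular⇒semi (forestˡ sp F) E toR fromR W
    , weaklySemiregular⇒semi (forestʳ sp F) E′ toB fromB W′
    where
    fromR : ∀ {u v} → Incident R u v → v ∈ ends E u
    fromR = [ R⇒E , EdgeSet.symmetric E ∘ R⇒E ]′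
    ¬fromB : ∀ {u v} → Incident B u v → ¬ v ∈ ends E u
    ¬fromB = [ B⇒¬E , (λ i x → B⇒¬E i (EdgeSet.symmetric E x)) ]′
    fromB : ∀ {u v} → Incident B u v → v ∈ ends E′ u
    fromB i = [ (λ x → contradiction x (¬fromB i)) , id ]′ (cov (L⊆T (incidentʳ sp i)))
    toR : ∀ {u v} → v ∈ ends E u → Incident R u v
    toR x = [ id , (λ i → contradiction x (¬fromB i)) ]′ (incident-split sp (T⊆L (EdgeSet.⊆edges E x)))
    toB : ∀ {u v} → v ∈ ends E′ u → Incident B u v
    toB x = [ (λ i → contradiction x (dis (fromR i))) , id ]′
      (incident-split sp (T⊆L (EdgeSet.⊆edges E′ x)))

-- The candidate pairs, and feasibility of the complete edge list

data Candidate (D x : ℕ) : ℕ → ℕ → Set where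
  full   : Candidate D x D x
  almost : Candidate D x (D ∸ 1) x
  sum    : Candidate D x x (D ∸ x)

module _ {n : ℕ} where

  -- At a vertex of maximal degree D the two colour degrees add up to D.
  candidate : ∀ {L R B : List (Edge (suc n))} {D w} → Interleaving R B L →
    (∀ v → deg L v ≤ D) → deg L w ≡ D → (∀ v → deg L v ≤ suc n) →
    (∃ λ α → Semi α (deg R)) → (∃ λ β → Semi β (deg B)) →
    ∃₂ λ x α → ∃ λ β → x ≤ suc n × Candidate D x α β ×
      ∃₂ λ R′ B′ → Interleaving R′ B′ L × Semi α (deg R′) × Semi β (deg B′)
  candidate {L} {R} {B} {D} {w} sp ≤D dw ≤N (_ , SR₀) (_ , SB₀)
    with semi-bounded (suc n) (λ v → ≤-trans (degˡ-≤ sp v) (≤N v)) SR₀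
       | semi-bounded (suc n) (λ v → ≤-trans (degʳ-≤ sp v) (≤N v)) SB₀
  ... | α , α≤ , SR | β , β≤ , SB = choose (SR w) (SB w)
    where
    D≡ : deg R w + deg B w ≡ D
    D≡ = trans (sym (deg-split sp w)) dw
    Goal : Set
    Goal = ∃₂ λ x α → ∃ λ β → x ≤ suc n × Candidate D x α β ×
      ∃₂ λ R′ B′ → Interleaving R′ B′ L × Semi α (deg R′) × Semi β (deg B′)
    straight : ∀ {x α β} → x ≤ suc n → Candidate D x α β → Semi α (deg R) → Semi β (deg B) → Goal
    straight x≤ C SR SB = _ , _ , _ , x≤ , C , R , B , sp , SR , SB
    swapped : ∀ {x α β} → x ≤ suc n → Candidate D x β α → Semi α (deg R) → Semi β (deg B) → Goal
    swapped x≤ C SR SB = _ , _ , _ , x≤ , C , B , R , swap sp , SB , SR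
    -- If both colour degrees at `w` are at most 1, they determine neither `α` nor `β`. But then
    -- `D ≤ 2`, and every red degree is 0, 1 or `D`, so `D` can replace `α`.
    small : D ≤ 2 → Goal
    small D≤2 = straight β≤ full (λ v → below (≤-trans (degˡ-≤ sp v) (≤D v)) D≤2) SB
      where
      below : ∀ {d D} → d ≤ D → D ≤ 2 → Among D d
      below {0} _ _ = inj₁ refl
      below {1} _ _ = inj₂ (inj₁ refl)
      below {2} d≤D D≤2 = inj₂ (inj₂ (≤-antisym d≤D D≤2))
      below {suc (suc (suc _))} d≤D D≤2 with s≤s (s≤s ()) ← ≤-trans d≤D D≤2
    at-most-2 : deg R w ≤ 1 → deg B w ≤ 1 → Goal
    at-most-2 r≤1 b≤1 = small (subst (_≤ 2) D≡ (+-mono-≤ r≤1 b≤1))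
    choose : Among α (deg R w) → Among β (deg B w) → Goal
    choose (inj₁ r) (inj₁ b) = at-most-2 (≤-trans (≤-reflexive r) z≤n) (≤-trans (≤-reflexive b) z≤n)
    choose (inj₁ r) (inj₂ (inj₁ b)) = at-most-2 (≤-trans (≤-reflexive r) z≤n) (≤-reflexive b)
    choose (inj₂ (inj₁ r)) (inj₁ b) = at-most-2 (≤-reflexive r) (≤-trans (≤-reflexive b) z≤n)
    choose (inj₂ (inj₁ r)) (inj₂ (inj₁ b)) = at-most-2 (≤-reflexive r) (≤-reflexive b)
    choose (inj₂ (inj₂ r)) (inj₁ b) =
      straight β≤ full (subst (λ z → Semi z (deg R))
        (trans (sym r) (trans (sym (+-identityʳ _)) (trans (cong (_ +_) (sym b)) D≡))) SR) SB
    choose (inj₁ r) (inj₂ (inj₂ b)) =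
      swapped α≤ full SR (subst (λ z → Semi z (deg B)) (trans (sym b) (trans (cong (_+ _) (sym r)) D≡)) SB)
    choose (inj₂ (inj₂ r)) (inj₂ (inj₁ b)) =
      straight β≤ almost (subst (λ z → Semi z (deg R))
        (trans (sym r) (trans (sym (m+n∸n≡m (deg R w) 1))
          (trans (cong (λ z → deg R w + z ∸ 1) (sym b)) (cong (_∸ 1) D≡)))) SR) SB
    choose (inj₂ (inj₁ r)) (inj₂ (inj₂ b)) =
      swapped α≤ almost SR (subst (λ z → Semi z (deg B))
        (trans (sym b) (trans (cong (λ z → z + deg B w ∸ 1) (sym r)) (cong (_∸ 1) D≡))) SB)
    choose (inj₂ (inj₂ r)) (inj₂ (inj₂ b)) =
      straight α≤ sum SR (subst (λ z → Semi z (deg B))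
        (trans (sym b) (trans (sym (m+n∸m≡n (deg R w) _)) (cong₂ _∸_ D≡ r))) SB)

  module _ {α β : ℕ} {L : List (Edge (suc n))} where

    -- When nothing has been removed, the red and blue degrees add up to the whole degree. The
    -- interval for `s` is then a single point, the red degree.
    feasible⇒semi : (∀ v → Reached L v) → Feasible α β (deg L) L (λ _ → 0) (λ _ → 0) →
      ∃₂ λ R B → Interleaving R B L × Semi α (deg R) × Semi β (deg B)
    feasible⇒semi all (R , B , sp , ok) = R , B , sp , (λ v → proj₁ (exact v)) , λ v → proj₂ (exact v)
      where
      exact : ∀ v → Among α (deg R v) × Among β (deg B v)
      exact v with ok v (all v)
      ... | s , A , A′ , r≤s , s+b≤d
        with refl ← ≤-antisym r≤s (+-cancelʳ-≤ (deg B v) s (deg R v)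
          (subst (s + deg B v ≤_) (deg-split sp v) s+b≤d))
        = A , subst (Among β) (trans (cong (_∸ s) (deg-split sp v)) (m+n∸m≡n s _)) A′

    semi⇒feasible : ∀ {R B} → Interleaving R B L → Semi α (deg R) → Semi β (deg B) →
      Feasible α β (deg L) L (λ _ → 0) (λ _ → 0)
    semi⇒feasible {R} {B} sp SR SB = R , B , sp , λ v _ → deg R v , SR v ,
      subst (Among β) (sym (trans (cong (_∸ deg R v) (deg-split sp v)) (m+n∸m≡n (deg R v) _))) (SB v) ,
      ≤-refl , ≤-reflexive (sym (deg-split sp v))

-- Structured programs

choose : {A : Set} → ℕ → A → A → A
choose zero    x y = y
choose (suc _) x y = x

-- exec and time are meaningful for loop-free programs only.
exec : Program → State → State
exec skip          s = s
exec (set x e)     s = setRegister x (eval e s) s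
exec (store a e f) s = setCell a (eval e s) (eval f s) s
exec (p ⨾ q)       s = exec q (exec p s)
exec (cond e p q)  s = choose (eval e s) (exec p s) (exec q s)
exec (while e p)   s = s

LoopFree : Program → Set
LoopFree (p ⨾ q)      = LoopFree p × LoopFree q
LoopFree (cond e p q) = LoopFree p × LoopFree q
LoopFree (while e p)  = Empty
LoopFree _            = Unit

-- An upper bound rather than the exact cost: a conditional is charged for both branches, which
-- makes the bound independent of the state.
time : Program → ℕ
time skip          = 1
time (set x e)     = suc (cost e)
time (store a e f) = suc (cost e + cost f)
time (p ⨾ q)       = time p + time q
time (cond e p q)  = suc (cost e + (time p + time q))
time (while e p)   = 0

exec-cond : (P : State → Set) → ∀ e p q s → (eval e s ≢ 0 → P (exec p s)) → (eval e s ≡ 0 → P (exec q s)) →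
            P (exec (cond e p q) s)
exec-cond P e p q s then else with eval e s
... | zero  = else refl
... | suc _ = then λ ()

Runs : Program → State → ℕ → (State → Set) → Set
Runs p s T Q = ∃₂ λ t s′ → ⟨ p , s ⟩⇓[ t ] s′ × t ≤ T × Q s′

exec-sound : ∀ p s → LoopFree p → Runs p s (time p) (_≡ exec p s)
exec-sound skip          s _ = _ , _ , ⇓skip , ≤-refl , refl
exec-sound (set x e)     s _ = _ , _ , ⇓set , ≤-refl , refl
exec-sound (store a e f) s _ = _ , _ , ⇓store , ≤-refl , refl
exec-sound (p ⨾ q) s (lp , lq) with exec-sound p s lp
... | _ , _ , P , t≤ , refl with exec-sound q (exec p s) lq
...   | _ , _ , Q , t′≤ , refl = _ , _ , ⇓seq P Q , +-mono-≤ t≤ t′≤ , refl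
exec-sound (cond e p q) s (lp , lq) with eval e s in eq
... | zero with exec-sound q s lq
...   | _ , _ , Q , t≤ , refl =
  _ , _ , ⇓else eq Q , s≤s (+-monoʳ-≤ (cost e) (m≤n⇒m≤o+n (time p) t≤)) , refl
exec-sound (cond e p q) s (lp , lq) | suc _ with exec-sound p s lp
...   | _ , _ , P , t≤ , refl =
  _ , _ , ⇓then (λ ≡0 → case trans (sym eq) ≡0 of λ ()) P , s≤s
    (+-monoʳ-≤ (cost e) (m≤n⇒m≤n+o (time q) t≤)) , refl

runs-exec : ∀ p {s Q} → LoopFree p → Q (exec p s) → Runs p s (time p) Q
runs-exec p {s} lf q with exec-sound p s lf
... | t , _ , P , t≤ , refl = t , _ , P , t≤ , q

runs-seq : ∀ {p q s T T′ Q Q′} → Runs p s T Q → (∀ s′ → Q s′ → Runs q s′ T′ Q′) → Runs (p ⨾ q) s (T + T′) Q′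
runs-seq (t , s′ , P , t≤ , q) next with next s′ q
... | t′ , s″ , P′ , t′≤ , q′ = t + t′ , s″ , ⇓seq P P′ , +-mono-≤ t≤ t′≤ , q′

-- The index of the invariant is a variant that every pass lowers, so there are at most `K` passes;
-- the extra unit in `suc K` pays for the last, failing test.
runs-while : ∀ {e p} (I : ℕ → State → Set) C →
  (∀ k s → I k s → eval e s ≢ 0 → Runs p s C λ s′ → ∃ λ k′ → k′ < k × I k′ s′) →
  ∀ K {k s} → k ≤ K → I k s →
  Runs (while e p) s (suc K * (suc (cost e) + C)) λ s′ → eval e s′ ≡ 0 × ∃ λ k′ → I k′ s′
runs-while {e} {p} I C body K {k} {s} k≤K i with eval e s ≟ 0
... | yes ≡0 = _ , s , ⇓exit ≡0 , ≤-trans (m≤m+n (suc (cost e)) C) (m≤m+n _ _) , ≡0 , k , i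
... | no ≢0 with body k s i ≢0
...   | t , s₁ , P , t≤ , k₁ , k₁<k , i₁ with K
...     | zero with () ← ≤-trans k₁<k k≤K
...     | suc K with runs-while {e} {p} I C body K (s≤s⁻¹ (≤-trans k₁<k k≤K)) i₁
...       | t′ , s₂ , P′ , t′≤ , q =
  _ , s₂ , ⇓loop ≢0 P P′ ,
  ≤-trans (s≤s (+-monoʳ-≤ (cost e) (+-mono-≤ t≤ t′≤))) (≤-reflexive (sym (+-assoc (suc (cost e)) C _))) , q

-- Array updates and arithmetic tests

update-here : ∀ {A : Set} x (a : A) f → update x a f x ≡ a
update-here x a f rewrite dec-true (x ≟ x) refl = refl

update-elsewhere : ∀ {A : Set} {x y} (a : A) f → x ≢ y → update x a f y ≡ f y
update-elsewhere {x = x} {y} a f x≢y rewrite dec-false (x ≟ y) x≢y = refl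

update-vertex : ∀ {N} {u v : Fin N} a (f : ℕ → ℕ) → u ≢ v → update (toℕ u) a f (toℕ v) ≡ f (toℕ v)
update-vertex a f u≢v = update-elsewhere a f (u≢v ∘ toℕ-injective)

increment : ∀ {N} (u v : Fin N) (f : ℕ → ℕ) → update (toℕ u) (f (toℕ u) + 1) f (toℕ v) ≡ δ u v + f (toℕ v)
increment u v f with u ≟ᶠ v
... | yes refl = trans (update-here (toℕ u) _ f) (+-comm _ 1)
... | no u≢v   = update-vertex (f (toℕ u) + 1) f u≢v

contents-map : ∀ {A : Set} (f : A → ℕ) xs i → contents (map f xs) (toℕ i) ≡ f (lookup xs i)
contents-map f (x ∷ xs) zero    = refl
contents-map f (x ∷ xs) (suc i) = contents-map f xs i

-- The minimum.  A test succeeds with value 0, so this is a disjunction of tests.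
minE : Expr → Expr → Expr
minE e f = sub e (sub e f)

min≡0⁻ : ∀ x y → x ∸ (x ∸ y) ≡ 0 → x ≡ 0 ⊎ y ≡ 0
min≡0⁻ zero    y       _  = inj₁ refl
min≡0⁻ (suc x) zero    _  = inj₂ refl
min≡0⁻ (suc x) (suc y) eq = contradiction (m∸n≡0⇒m≤n {suc x} eq) (<⇒≱ (s≤s (m∸n≤m x y)))

min≡0⁺ : ∀ x y → x ≡ 0 ⊎ y ≡ 0 → x ∸ (x ∸ y) ≡ 0
min≡0⁺ x y (inj₁ refl) = 0∸n≡0 (0 ∸ y)
min≡0⁺ x y (inj₂ refl) = n∸n≡0 x

-- Truncated subtraction is the only comparison: `sub e f` vanishes when `e` is at most `f`. A sum
-- of tests is their conjunction, so this one tests equality.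
distE : Expr → Expr → Expr
distE e f = add (sub e f) (sub f e)

dist≡0⁻ : ∀ x y → (x ∸ y) + (y ∸ x) ≡ 0 → x ≡ y
dist≡0⁻ x y eq = ≤-antisym (m∸n≡0⇒m≤n (m+n≡0⇒m≡0 (x ∸ y) eq)) (m∸n≡0⇒m≤n (m+n≡0⇒n≡0 (x ∸ y) eq))

dist≡0⁺ : ∀ x → (x ∸ x) + (x ∸ x) ≡ 0
dist≡0⁺ x rewrite n∸n≡0 x = refl

-- Zero precisely when s, if it is 0, 1 or α, witnesses OK α β r b d.
violationE : Expr → Expr → Expr → Expr → Expr → Expr
violationE β r b d s =
  add (add (sub r s) (sub (add s b) d)) (minE (sub (sub d s) (lit 1)) (distE (sub d s) β))

violation : ℕ → ℕ → ℕ → ℕ → ℕ → ℕ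
violation β r b d s = ((r ∸ s) + ((s + b) ∸ d)) + (x ∸ (x ∸ y))
  where
  x = d ∸ s ∸ 1
  y = (d ∸ s ∸ β) + (β ∸ (d ∸ s))

violation⁻ : ∀ α β r b d s → Among α s → violation β r b d s ≡ 0 → OK α β r b d
violation⁻ α β r b d s A eq = s , A , among
  , m∸n≡0⇒m≤n (m+n≡0⇒m≡0 (r ∸ s) eq₁) , m∸n≡0⇒m≤n (m+n≡0⇒n≡0 (r ∸ s) eq₁)
  where
  eq₁ = m+n≡0⇒m≡0 ((r ∸ s) + ((s + b) ∸ d)) eq
  ≤1 : ∀ x → x ∸ 1 ≡ 0 → x ≡ 0 ⊎ x ≡ 1
  ≤1 0 _ = inj₁ refl
  ≤1 1 _ = inj₂ refl
  among : Among β (d ∸ s)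
  among with min≡0⁻ (d ∸ s ∸ 1) _ (m+n≡0⇒n≡0 ((r ∸ s) + ((s + b) ∸ d)) eq)
  ... | inj₁ z = [ inj₁ , inj₂ ∘ inj₁ ]′ (≤1 (d ∸ s) z)
  ... | inj₂ z = inj₂ (inj₂ (dist≡0⁻ (d ∸ s) β z))

violation⁺ : ∀ {α β r b d} ((s , _) : OK α β r b d) → violation β r b d s ≡ 0
violation⁺ {α} {β} {r} {b} {d} (s , _ , A′ , r≤s , s+b≤d) =
  cong₂ _+_ (cong₂ _+_ (m≤n⇒m∸n≡0 r≤s) (m≤n⇒m∸n≡0 s+b≤d)) (min≡0⁺ (d ∸ s ∸ 1) _ (zeros A′))
  where
  zeros : Among β (d ∸ s) → d ∸ s ∸ 1 ≡ 0 ⊎ (d ∸ s ∸ β) + (β ∸ (d ∸ s)) ≡ 0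
  zeros (inj₁ z)        = inj₁ (cong (_∸ 1) z)
  zeros (inj₂ (inj₁ z)) = inj₁ (cong (_∸ 1) z)
  zeros (inj₂ (inj₂ z)) = inj₂ (trans (cong (λ y → (y ∸ β) + (β ∸ y)) z) (dist≡0⁺ β))

-- The witness in `OK` is 0, 1 or `α`, so the existential quantifier turns into a disjunction of
-- three tests.
notOKE : Expr → Expr → Expr → Expr → Expr → Expr
notOKE α β r b d = minE (violationE β r b d (lit 0))
  (minE (violationE β r b d (lit 1)) (violationE β r b d α))

notOK⁻ : ∀ α β r b d {s} → eval (notOKE α β r b d) s ≡ 0 →
         OK (eval α s) (eval β s) (eval r s) (eval b s) (eval d s)
notOK⁻ α β r b d {s} eq with min≡0⁻ (violation (eval β s) (eval r s) (eval b s) (eval d s) 0) _ eq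
... | inj₁ z = violation⁻ _ _ (eval r s) _ _ 0 (inj₁ refl) z
... | inj₂ eq′ with min≡0⁻ (violation (eval β s) (eval r s) (eval b s) (eval d s) 1) _ eq′
...   | inj₁ z = violation⁻ _ _ (eval r s) _ _ 1 (inj₂ (inj₁ refl)) z
...   | inj₂ z = violation⁻ _ _ (eval r s) _ _ (eval α s) (inj₂ (inj₂ refl)) z

notOK⁺ : ∀ α β r b d {s} → OK (eval α s) (eval β s) (eval r s) (eval b s) (eval d s) →
         eval (notOKE α β r b d) s ≡ 0
notOK⁺ α β r b d {s} ok@(_ , A , _) = min≡0⁺ v₀ _ (zeros A (violation⁺ ok))
  where
  v = violation (eval β s) (eval r s) (eval b s) (eval d s)
  v₀ = v 0
  zeros : ∀ {t} → Among (eval α s) t → v t ≡ 0 → v 0 ≡ 0 ⊎ (v 1 ∸ (v 1 ∸ v (eval α s))) ≡ 0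
  zeros (inj₁ refl)        z = inj₁ z
  zeros (inj₂ (inj₁ refl)) z = inj₂ (min≡0⁺ (v 1) (v (eval α s)) (inj₁ z))
  zeros (inj₂ (inj₂ refl)) z = inj₂ (min≡0⁺ (v 1) (v (eval α s)) (inj₂ z))

-- The program

-- The first #k cells of $parent and $child hold the edges attached so far, and
-- $degree the degrees they give.  In a check, $red and $blue hold the forced
-- edges of the vertices that are not yet removed, and 0 elsewhere.

#n #m #i #k #D #p #c #x #found #α #β #j #bad : ℕ
#n = 0
#m = 1
#i = 2
#k = 3
#D = 4
#p = 5
#c = 6
#x = 7
#found = 8
#α = 9
#β = 10
#j = 11
#bad = 12

$fst $snd $seen $parent $child $degree $red $blue : ℕ
$fst = 0
$snd = 1
$seen = 2
$parent = 3
$child = 4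
$degree = 5
$red = 6
$blue = 7

increase : ℕ → ℕ → Program
increase a x = store a (reg x) (add (cell a (reg x)) (lit 1))

attach : Program
attach =
  store $parent (reg #k) (reg #p) ⨾
  store $child (reg #k) (reg #c) ⨾
  store $seen (reg #c) (lit 1) ⨾
  increase $degree #c ⨾
  increase $degree #p ⨾
  set #k (add (reg #k) (lit 1)) ⨾
  set #i (lit 0)

onlySeen : ℕ → ℕ → Expr
onlySeen a b = sub (cell $seen (cell a (reg #i))) (cell $seen (cell b (reg #i)))

attachEnds : ℕ → ℕ → Program
attachEnds a b = set #p (cell a (reg #i)) ⨾ set #c (cell b (reg #i)) ⨾ attach

next : Program
next = set #i (add (reg #i) (lit 1))

-- Attaching an edge restarts the scan, so that no edge before #i ever leaves the
-- set of seen vertices.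
scan : Program
scan =
  cond (onlySeen $fst $snd) (attachEnds $fst $snd)
    (cond (onlySeen $snd $fst) (attachEnds $snd $fst) next)

growth : Program
growth =
  store $seen (lit 0) (lit 1) ⨾
  while (sub (reg #m) (reg #i)) scan

-- The number of passes is bounded by the initial value `remaining [] 0` of the variant of the scan.
growthSteps : ℕ → ℕ → ℕ
growthSteps n m = time (store $seen (lit 0) (lit 1)) +
  suc (suc n * suc m + m) * (suc (cost (sub (reg #m) (reg #i))) + time scan)

-- The head of the list is the newest edge and occupies the last used cell, whose index is the
-- length of the tail.
Stored : ∀ {N} → (ℕ → ℕ) → (ℕ → ℕ) → List (Edge N) → Set
Stored P C []            = Unit
Stored P C ((p , c) ∷ L) = P (length L) ≡ toℕ p × C (length L) ≡ toℕ c × Stored P C L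

stored-update : ∀ {N P C i x y} (L : List (Edge N)) → length L ≤ i → Stored P C L →
                Stored (update i x P) (update i y C) L
stored-update []            _   _             = tt
stored-update {P = P} {C} {i} {x} {y} ((p , c) ∷ L) L<i (Pp , Cc , St) =
  trans (update-elsewhere x P (>⇒≢ L<i)) Pp , trans (update-elsewhere y C (>⇒≢ L<i)) Cc ,
  stored-update L (<⇒≤ L<i) St

-- Correctness of the growth phase

module _ {n : ℕ} where

  record Static (L : List (Edge (suc n))) (s : State) : Set where
    field
      reg-n   : register s #n ≡ suc n
      reg-k   : register s #k ≡ length L
      stored  : Stored (array s $parent) (array s $child) L
      degrees : ∀ v → array s $degree (toℕ v) ≡ deg L v

  -- A check zeroes the counters of each vertex that it removes, so all checks can share the two
  -- arrays.
  record Clean (s : State) : Set where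
    field
      red-0  : ∀ (v : Fin (suc n)) → array s $red (toℕ v) ≡ 0
      blue-0 : ∀ (v : Fin (suc n)) → array s $blue (toℕ v) ≡ 0

  Seen : List (Edge (suc n)) → Fin (suc n) → ℕ → Set
  Seen L v x = (x ≡ 1 × Reached L v) ⊎ (x ≡ 0 × ¬ Reached L v)

  seen>⇒ : ∀ {L u v x y} → Seen L u x → Seen L v y → x ∸ y ≢ 0 → Reached L u × ¬ Reached L v
  seen>⇒ (inj₁ (refl , ru)) (inj₁ (refl , rv)) ≢0 = contradiction refl ≢0
  seen>⇒ (inj₁ (refl , ru)) (inj₂ (refl , ¬v)) ≢0 = ru , ¬v
  seen>⇒ {y = y} (inj₂ (refl , ¬u)) _          ≢0 = contradiction (0∸n≡0 y) ≢0

  seen≤⇒ : ∀ {L u v x y} → Seen L u x → Seen L v y → x ∸ y ≡ 0 → Reached L u → Reached L v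
  seen≤⇒ _                  (inj₁ (refl , rv)) _  _  = rv
  seen≤⇒ (inj₁ (refl , ru)) (inj₂ (refl , ¬v)) () _
  seen≤⇒ (inj₂ (refl , ¬u)) (inj₂ (refl , ¬v)) _  ru = contradiction ru ¬u

  module Growth (T : Graph (suc n)) (es : List (Edge (suc n))) (isList : IsEdgeList T es) where

    record Growing (L : List (Edge (suc n))) (i : ℕ) (s : State) : Set where
      field
        static : Static L s
        clean  : Clean s
        reg-m  : register s #m ≡ length es
        reg-i  : register s #i ≡ i
        fsts   : ∀ j → array s $fst (toℕ j) ≡ toℕ (proj₁ (lookup es j))
        snds   : ∀ j → array s $snd (toℕ j) ≡ toℕ (proj₂ (lookup es j))
        seen   : ∀ v → Seen L v (array s $seen (toℕ v))
        grown  : Grown L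
        ⊆T     : ∀ {u v} → Incident L u v → Adjacent T u v
        closed : ∀ j → toℕ j < i → let u , v = lookup es j in Reached L u ⇔ Reached L v

    attach-growing : ∀ {L i s p c} → Growing L i s → Reached L p → ¬ Reached L c → Adjacent T p c →
      Growing ((p , c) ∷ L) 0 (exec attach (setRegister #c (toℕ c) (setRegister #p (toℕ p) s)))
    attach-growing {L} {i} {s} {p} {c} g rp ¬rc pc = record
      { static = record
        { reg-n   = reg-n
        ; reg-k   = trans (cong (_+ 1) reg-k) (+-comm (length L) 1)
        ; stored  = at-k (array s $parent) , at-k (array s $child)
                  , stored-update L (≤-reflexive (sym reg-k)) stored
        ; degrees = λ v → trans (increment p v
          (update (toℕ c) (array s $degree (toℕ c) + 1) (array s $degree))) (cong (δ p v +_)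
                      (trans (increment c v (array s $degree)) (cong (δ c v +_) (degrees v))))
        }
      ; clean  = record { Clean clean }
      ; reg-m  = reg-m
      ; reg-i  = refl
      ; fsts   = fsts
      ; snds   = snds
      ; seen   = seen′
      ; grown  = cons rp ¬rc grown
      ; ⊆T     = λ where
          (inj₁ (here refl)) → pc
          (inj₁ (there i))   → ⊆T (inj₁ i)
          (inj₂ (here refl)) → Graph.symmetric T pc
          (inj₂ (there i))   → ⊆T (inj₂ i)
      ; closed = λ _ ()
      }
      where
      open Growing g
      open Static static
      at-k : ∀ {x} f → update (register s #k) x f (length L) ≡ x
      at-k f rewrite reg-k = update-here (length L) _ f
      seen′ : ∀ v → Seen ((p , c) ∷ L) v (update (toℕ c) 1 (array s $seen) (toℕ v))
      seen′ v with c ≟ᶠ v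
      ... | yes refl = inj₁ (update-here (toℕ c) 1 (array s $seen) , inj₁ refl)
      ... | no c≢v   = subst (Seen ((p , c) ∷ L) v) (sym (update-vertex 1 (array s $seen) c≢v))
        (Sum.map (Product.map₂ inj₂) (Product.map₂ (λ ¬rv → [ c≢v ∘ sym , ¬rv ]′)) (seen v))

    edge∈T : ∀ j → let u , v = lookup es j in Adjacent T u v
    edge∈T j = from (proj₁ isList _ _) (inj₁ (∈-lookup j))

    -- A lexicographic variant coded as a number. Attaching an edge lowers the first factor and may
    -- reset the second summand to `length es`, which the weight `suc (length es)` outweighs.
    remaining : List (Edge (suc n)) → ℕ → ℕ
    remaining L i = (suc n ∸ length L) * suc (length es) + (length es ∸ i)

    Progress : ℕ → State → Set
    Progress k s = ∃₂ λ L i → Growing L i s × k ≡ remaining L i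

    remaining-attach : ∀ {L : List (Edge (suc n))} e i → length L < suc n →
      remaining (e ∷ L) 0 < remaining L i
    remaining-attach {L} e i L<N = begin-strict
      (n ∸ length L) * suc (length es) + length es        <⟨ +-monoʳ-<
        ((n ∸ length L) * suc (length es)) (n<1+n _) ⟩
      (n ∸ length L) * suc (length es) + suc (length es)  ≡⟨ +-comm ((n ∸ length L) * suc (length es)) _ ⟩
      suc (n ∸ length L) * suc (length es)                ≡⟨ cong (_* suc (length es))
        (+-∸-assoc 1 (s≤s⁻¹ L<N)) ⟨
      (suc n ∸ length L) * suc (length es)                ≤⟨ m≤m+n _ _ ⟩
      remaining L i                                       ∎
      where open ≤-Reasoning

    scan-progress : ∀ k s → Progress k s → eval (sub (reg #m) (reg #i)) s ≢ 0 →
                    ∃ λ k′ → k′ < k × Progress k′ (exec scan s)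
    scan-progress k s (L , i , g , refl) ≢0 =
      exec-cond P (onlySeen $fst $snd) (attachEnds $fst $snd)
        (cond (onlySeen $snd $fst) (attachEnds $snd $fst) next) s
        (λ u>v → let ru , ¬rv = seen>⇒ {L} seen-u seen-v u>v in
          _ , remaining-attach {L} (u , v) i L<N , _ , _ ,
          subst₂ (λ x y → Growing ((u , v) ∷ L) 0 (exec attach (setRegister #c y (setRegister #p x s))))
            (sym at-u) (sym at-v) (attach-growing g ru ¬rv (edge∈T j)) , refl)
        λ u≤v → exec-cond P (onlySeen $snd $fst) (attachEnds $snd $fst) next s
          (λ v>u → let rv , ¬ru = seen>⇒ {L} seen-v seen-u v>u in
            _ , remaining-attach {L} (v , u) i L<N , _ , _ ,
            subst₂ (λ x y → Growing ((v , u) ∷ L) 0 (exec attach (setRegister #c y (setRegister #p x s))))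
              (sym at-v) (sym at-u) (attach-growing g rv ¬ru (Graph.symmetric T (edge∈T j))) , refl)
          λ v≤u → _ , +-monoʳ-< ((suc n ∸ length L) * suc (length es))
            (∸-monoʳ-< (n<1+n i) i<m) , L , suc i , record
            { static = record { Static static } ; clean = record { Clean clean }
            ; reg-m = reg-m ; reg-i = trans (cong (_+ 1) reg-i) (+-comm i 1)
            ; fsts = fsts ; snds = snds ; seen = seen ; grown = grown ; ⊆T = ⊆T
            ; closed = λ j′ j′<1+i → case m≤n⇒m<n∨m≡n (s≤s⁻¹ j′<1+i) of λ where
                (inj₁ j′<i) → closed j′ j′<i
                (inj₂ j′≡i) → case toℕ-injective (trans j′≡i (sym toℕ-j)) of λ where
                  refl → mk⇔ (seen≤⇒ {L} seen-u seen-v u≤v) (seen≤⇒ {L} seen-v seen-u v≤u)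
            } , refl
      where
      open Growing g
      P : State → Set
      P s′ = ∃ λ k′ → k′ < remaining L i × Progress k′ s′
      i<m : i < length es
      i<m = m∸n≢0⇒n<m (subst₂ (λ x y → x ∸ y ≢ 0) reg-m reg-i ≢0)
      L<N : length L < suc n
      L<N = s≤s (grown-length grown)
      j = fromℕ< i<m
      toℕ-j : toℕ j ≡ i
      toℕ-j = toℕ-fromℕ< i<m
      u = proj₁ (lookup es j)
      v = proj₂ (lookup es j)
      at-u : array s $fst (register s #i) ≡ toℕ u
      at-u = trans (cong (array s $fst) (trans reg-i (sym toℕ-j))) (fsts j)
      at-v : array s $snd (register s #i) ≡ toℕ v
      at-v = trans (cong (array s $snd) (trans reg-i (sym toℕ-j))) (snds j)
      seen-u : Seen L u (array s $seen (array s $fst (register s #i)))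
      seen-u = subst (Seen L u ∘ array s $seen) (sym at-u) (seen u)
      seen-v : Seen L v (array s $seen (array s $snd (register s #i)))
      seen-v = subst (Seen L v ∘ array s $seen) (sym at-v) (seen v)

    growing-start : Growing [] 0 (exec (store $seen (lit 0) (lit 1)) (input (suc n) es))
    growing-start = record
      { static = record { reg-n = refl ; reg-k = refl ; stored = tt ; degrees = λ _ → refl }
      ; clean = record { red-0 = λ _ → refl ; blue-0 = λ _ → refl }
      ; reg-m = refl ; reg-i = refl
      ; fsts = contents-map (toℕ ∘ proj₁) es ; snds = contents-map (toℕ ∘ proj₂) es
      ; seen = λ { zero → inj₁ (refl , refl) ; (suc v) → inj₂ (refl , λ ()) }
      ; grown = [] ; ⊆T = λ { (inj₁ ()) ; (inj₂ ()) } ; closed = λ _ ()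
      }

    Spanned : State → Set
    Spanned s = ∃ λ L → Static L s × Clean s × Grown L × (∀ v → Reached L v) × Spans T L

    -- After a complete scan `closed` says that no edge leaves the reached set. It contains the
    -- root, so connectedness makes it everything, and acyclicity then puts every edge of `T` into
    -- `L`.
    spanned : IsTree T → vertices T ≡ ⊤ → ∀ {L i s} → Growing L i s → length es ≤ i → Spanned s
    spanned ((_ , connected) , acyclic) V≡⊤ {L} {i} g m≤i =
      L , static , clean , grown , reached , grown⇒forest grown , ⊆T , acyclic⇒⊆ T acyclic grown ⊆T reached
      where
      open Growing g
      closed-at : ∀ {u v} → (u , v) ∈ˡ es → Reached L u ⇔ Reached L v
      closed-at k = subst (λ (u , v) → Reached L u ⇔ Reached L v) (sym (lookup-index k))
        (closed (index k) (≤-trans (toℕ<n (index k)) m≤i))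
      step : ∀ {u v} → Adjacent T u v → Reached L u → Reached L v
      step a = [ to ∘ closed-at , from ∘ closed-at ]′ (to (proj₁ isList _ _) a)
      walk : ∀ {u v} → Star (Adjacent T) u v → Reached L u → Reached L v
      walk ε       ru = ru
      walk (a ◅ w) ru = walk w (step a ru)
      reached : ∀ v → Reached L v
      reached v = walk (connected (subst (root ∈_) (sym V≡⊤) ∈⊤) (subst (v ∈_) (sym V≡⊤) ∈⊤))
        (reached-root L)

    runs-growth : IsTree T → vertices T ≡ ⊤ →
      Runs growth (input (suc n) es) (growthSteps n (length es)) Spanned
    runs-growth tree V≡⊤ =
      runs-seq {p = store $seen (lit 0) (lit 1)} {q = while (sub (reg #m) (reg #i)) scan}
        (runs-exec (store $seen (lit 0) (lit 1)) {Q = Growing [] 0} tt growing-start)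
        λ s g → finish (runs-while Progress (time scan)
          (λ k s p ≢0 → runs-exec scan _ (scan-progress k s p ≢0)) (remaining [] 0) ≤-refl
            (_ , _ , g , refl))
      where
      finish : ∀ {s T′} → Runs (while (sub (reg #m) (reg #i)) scan) s T′
        (λ s′ → eval (sub (reg #m) (reg #i)) s′ ≡ 0 × ∃ λ k → Progress k s′) →
        Runs (while (sub (reg #m) (reg #i)) scan) s T′ Spanned
      finish (t , s′ , R , t≤ , done , _ , L , i , g , _) = t , s′ , R , t≤ ,
        spanned tree V≡⊤ g (subst₂ _≤_ (Growing.reg-m g) (Growing.reg-i g) (m∸n≡0⇒m≤n done))

-- Programs for the maximal degree, the check of a pair and the search

maxDegreeStep : Program
maxDegreeStep =
  -- With truncated subtraction, D + (d ∸ D) is the maximum of D and d.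
  set #D (add (reg #D) (sub (cell $degree (reg #x)) (reg #D))) ⨾
  set #x (add (reg #x) (lit 1))

maxDegree : Program
maxDegree = set #D (lit 0) ⨾ set #x (lit 0) ⨾ while (sub (reg #n) (reg #x)) maxDegreeStep

pick : Program
pick =
  set #j (sub (reg #j) (lit 1)) ⨾
  set #p (cell $parent (reg #j)) ⨾
  set #c (cell $child (reg #j))

-- Nonzero when the edge from #c to its parent cannot be red, or blue.
notRed notBlue : Expr
notRed = notOKE (reg #α) (reg #β)
  (add (lit 1) (cell $red (reg #c))) (cell $blue (reg #c)) (cell $degree (reg #c))
notBlue = notOKE (reg #α) (reg #β)
  (cell $red (reg #c)) (add (lit 1) (cell $blue (reg #c))) (cell $degree (reg #c))

redForbidden redAllowed decide reset checkStep : Program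
redForbidden = cond notBlue (set #bad (lit 1)) (increase $blue #p)
redAllowed = cond notBlue (increase $red #p) skip
decide = cond notRed redForbidden redAllowed
reset = store $red (reg #c) (lit 0) ⨾ store $blue (reg #c) (lit 0)
checkStep = pick ⨾ decide ⨾ reset

rootFails : Expr
rootFails = add (reg #bad)
  (notOKE (reg #α) (reg #β) (cell $red (lit 0)) (cell $blue (lit 0)) (cell $degree (lit 0)))

checkRoot check : Program
checkRoot =
  cond rootFails skip (set #found (lit 1)) ⨾
  store $red (lit 0) (lit 0) ⨾ store $blue (lit 0) (lit 0)
check = (set #j (reg #k) ⨾ set #bad (lit 0)) ⨾ while (reg #j) checkStep ⨾ checkRoot

tryPair : Expr → Expr → Program
tryPair e f = (set #α e ⨾ set #β f) ⨾ check

searchStep search : Program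
searchStep =
  tryPair (reg #D) (reg #x) ⨾
  tryPair (sub (reg #D) (lit 1)) (reg #x) ⨾
  tryPair (reg #x) (sub (reg #D) (reg #x)) ⨾
  set #x (add (reg #x) (lit 1))
-- The 1 in the guard lets `#x` take the value of `#n` as well, which matches the bound on `x` in
-- `candidate`.
search = (set #found (lit 0) ⨾ set #x (lit 0)) ⨾ while (sub (add (reg #n) (lit 1)) (reg #x)) searchStep

maxDegreeSteps checkSteps : ℕ → ℕ
maxDegreeSteps n = time (set #D (lit 0)) + (time (set #x (lit 0)) +
  suc (suc n) * (suc (cost (sub (reg #n) (reg #x))) + time maxDegreeStep))
checkSteps n = time (set #j (reg #k) ⨾ set #bad (lit 0)) +
  (suc n * (suc (cost (reg #j)) + time checkStep) + time checkRoot)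

tryPairSteps : Expr → Expr → ℕ → ℕ
tryPairSteps e f n = time (set #α e ⨾ set #β f) + checkSteps n

searchStepSteps : ℕ → ℕ
searchStepSteps n =
  tryPairSteps (reg #D) (reg #x) n + (tryPairSteps (sub (reg #D) (lit 1)) (reg #x) n +
  (tryPairSteps (reg #x) (sub (reg #D) (reg #x)) n + time (set #x (add (reg #x) (lit 1)))))

searchSteps : ℕ → ℕ
searchSteps n = time (set #found (lit 0) ⨾ set #x (lit 0)) +
  suc (suc (suc n)) * (suc (cost (sub (add (reg #n) (lit 1)) (reg #x))) + searchStepSteps n)

-- Correctness of the maximal degree, the check and the search

module _ {n : ℕ} {L : List (Edge (suc n))} where

  record Maxing (i : ℕ) (s : State) : Set where
    field
      static   : Static L s
      clean    : Clean {n} s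
      reg-x    : register s #x ≡ i
      bound    : ∀ v → toℕ v < i → deg L v ≤ register s #D
      attained : register s #D ≡ 0 ⊎ ∃ λ w → deg L w ≡ register s #D

  record Maxed (s : State) : Set where
    field
      static   : Static L s
      clean    : Clean {n} s
      bound    : ∀ v → deg L v ≤ register s #D
      attained : ∃ λ w → deg L w ≡ register s #D

  maxing-step : ∀ {i s} → Maxing i s → i < suc n → Maxing (suc i) (exec maxDegreeStep s)
  maxing-step {i} {s} g i<N = record
    { static = record { Static static } ; clean = record { Clean clean }
    ; reg-x = trans (cong (_+ 1) reg-x) (+-comm i 1)
    ; bound = λ v v<1+i → case m≤n⇒m<n∨m≡n (s≤s⁻¹ v<1+i) of λ where
        (inj₁ v<i) → ≤-trans (bound v v<i) (m≤m+n D _)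
        (inj₂ v≡i) → ≤-trans (≤-reflexive (trans (sym (Static.degrees static v))
          (cong (array s $degree) (trans v≡i (sym reg-x))))) (m≤n+m∸n d D)
    ; attained = case ≤-total d D of λ where
        (inj₁ d≤D) → subst (λ z → z ≡ 0 ⊎ ∃ λ w → deg L w ≡ z)
          (sym (trans (cong (D +_) (m≤n⇒m∸n≡0 d≤D)) (+-identityʳ D))) attained
        (inj₂ D≤d) → inj₂ (w , trans (sym (Static.degrees static w))
          (trans (cong (array s $degree) (trans (toℕ-fromℕ< i<N) (sym reg-x))) (sym (m+[n∸m]≡n D≤d))))
    }
    where
    open Maxing g
    D = register s #D
    d = array s $degree (register s #x)
    w = fromℕ< i<N

  maxed : ∀ {i s} → Maxing i s → suc n ≤ i → Maxed s
  maxed {i} {s} g N≤i = record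
    { static = static ; clean = clean ; bound = bound′
    ; attained = [ (λ D≡0 → root , trans (n≤0⇒n≡0 (subst (deg L root ≤_) D≡0 (bound′ root)))
      (sym D≡0)) , id ]′ attained }
    where
    open Maxing g
    bound′ : ∀ v → deg L v ≤ register s #D
    bound′ v = bound v (≤-trans (toℕ<n v) N≤i)

  runs-maxDegree : ∀ {s} → Static L s → Clean {n} s → Runs maxDegree s (maxDegreeSteps n) Maxed
  runs-maxDegree st cl =
    runs-seq {p = set #D (lit 0)} (runs-exec
      (set #D (lit 0)) {Q = λ s → Static L s × Clean {n} s × register s #D ≡ 0} tt
      (record { Static st } , record { Clean cl } , refl))
    λ s₁ (st₁ , cl₁ , D≡0) →
    runs-seq {p = set #x (lit 0)} (runs-exec (set #x (lit 0)) {Q = Maxing 0} tt record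
      { static = record { Static st₁ } ; clean = record { Clean cl₁ } ; reg-x = refl
      ; bound = λ _ () ; attained = inj₁ D≡0 })
    λ s₂ g → finish (runs-while I (time maxDegreeStep)
      (λ { k s (i , g , refl) ≢0 →
        let i<N = m∸n≢0⇒n<m (subst₂ (λ x y → x ∸ y ≢ 0) (Static.reg-n (Maxing.static g)) (Maxing.reg-x g) ≢0)
        in runs-exec maxDegreeStep _ (_ , ∸-monoʳ-< (n<1+n i) i<N , suc i , maxing-step g i<N , refl) })
      (suc n) ≤-refl (0 , g , refl))
    where
    I : ℕ → State → Set
    I k s = ∃ λ i → Maxing i s × k ≡ suc n ∸ i
    finish : ∀ {s T} → Runs (while (sub (reg #n) (reg #x)) maxDegreeStep) s T
      (λ s′ → eval (sub (reg #n) (reg #x)) s′ ≡ 0 × ∃ λ k → I k s′) →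
      Runs (while (sub (reg #n) (reg #x)) maxDegreeStep) s T Maxed
    finish (t , s′ , R , t≤ , done , _ , i , g , _) = t , s′ , R , t≤ ,
      maxed g (subst₂ _≤_ (Static.reg-n (Maxing.static g)) (Maxing.reg-x g) (m∸n≡0⇒m≤n done))

  record Frame (D x f α β : ℕ) (s : State) : Set where
    field
      static    : Static L s
      reg-D     : register s #D ≡ D
      reg-x     : register s #x ≡ x
      reg-found : register s #found ≡ f
      reg-α     : register s #α ≡ α
      reg-β     : register s #β ≡ β

  reds blues : State → Fin (suc n) → ℕ
  reds s v = array s $red (toℕ v)
  blues s v = array s $blue (toℕ v)

  Goal : ℕ → ℕ → Set
  Goal α β = Feasible α β (deg L) L (λ _ → 0) (λ _ → 0)

  module _ {D x f α β : ℕ} where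

    -- A failure does not end the loop, which must still zero the remaining counters. From then on
    -- only the refutation of `Goal` is carried along.
    Verdict : List (Edge (suc n)) → ℕ → (Fin (suc n) → ℕ) → (Fin (suc n) → ℕ) → Set
    Verdict K bad r b = (bad ≡ 0 × (Goal α β ⇔ Feasible α β (deg L) K r b)) ⊎ (bad ≢ 0 × ¬ Goal α β)

    -- The field `budget` holds because a counted edge has left the list, and it supplies the gap
    -- that `feasible-either` requires. The field `idle` makes the arrays clean at the end.
    record Checking (j : ℕ) (K : List (Edge (suc n))) (s : State) : Set where
      field
        frame   : Frame D x f α β s
        reg-j   : register s #j ≡ j
        stored  : Stored (array s $parent) (array s $child) K
        grown   : Grown K
        budget  : ∀ v → Reached K v → reds s v + blues s v + deg K v ≤ deg L v
        idle    : ∀ v → ¬ Reached K v → reds s v + blues s v ≡ 0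
        verdict : Verdict K (register s #bad) (reds s) (blues s)

    record Picked (p c : Fin (suc n)) (K : List (Edge (suc n))) (s : State) : Set where
      field
        checking : Checking (length K) ((p , c) ∷ K) s
        reg-p    : register s #p ≡ toℕ p
        reg-c    : register s #c ≡ toℕ c

    pick-picked : ∀ {p c K s} → Checking (suc (length K)) ((p , c) ∷ K) s → Picked p c K (exec pick s)
    pick-picked {p} {c} {K} {s} g = record
      { checking = record { frame = record { Frame frame ; static = record { Static
        (Frame.static frame) } } ; reg-j = j≡
                          ; stored = stored ; grown = grown ; budget = budget ; idle = idle ; verdict = verdict }
      ; reg-p = trans (cong (array s $parent) j≡) (proj₁ stored)
      ; reg-c = trans (cong (array s $child) j≡) (proj₁ (proj₂ stored))
      }
      where
      open Checking g
      j≡ : register s #j ∸ 1 ≡ length K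
      j≡ = cong (_∸ 1) reg-j

    -- The part common to the four outcomes of `decide`. The counters after the decision are `ρ` and
    -- `σ`; by `spent` they exceed the old ones by at most one edge, charged to `p`.
    settle : ∀ {p c K s s′ ρ σ} → Picked p c K s → Frame D x f α β s′ → register s′ #j ≡ length K →
      register s′ #c ≡ toℕ c → Stored (array s′ $parent) (array s′ $child) K →
      (∀ v → reds s′ v ≡ ρ v) → (∀ v → blues s′ v ≡ σ v) →
      (∀ v → ρ v + σ v ≤ δ p v + (reds s v + blues s v)) →
      Verdict K (register s′ #bad) ρ σ → Checking (length K) K (exec reset s′)
    settle {p} {c} {K} {s} {s′} {ρ} {σ} pk fr j≡ c≡ st reds≡ blues≡ spent verd with grown | budget | idle
      where
      open Picked pk
      open Checking checking
    ... | cons rp ¬rc grown | budget | idle = record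
      { frame = record { Frame fr ; static = record { Static
        (Frame.static fr) } } ; reg-j = j≡ ; stored = st ; grown = grown
      ; budget = λ v rv → subst₂ (λ r b → r + b + deg K v ≤ deg L v) (sym (red-old rv))
        (sym (blue-old rv)) (within v (inj₂ rv))
      ; idle = idle′
      ; verdict = Sum.map₁ (Product.map₂ λ g⇔ → mk⇔
          (feasible-mono α β (deg L) (λ _ rv → ≤-reflexive (red-old rv))
            (λ _ rv → ≤-reflexive (blue-old rv)) ∘ to g⇔)
          (from g⇔ ∘ feasible-mono α β (deg L) (λ _ rv → ≤-reflexive (sym (red-old rv)))
            (λ _ rv → ≤-reflexive (sym (blue-old rv)))))
          verd
      }
      where
      cleared : ∀ {v} (A : ℕ → ℕ) → c ≢ v → update (register s′ #c) 0 A (toℕ v) ≡ A (toℕ v)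
      cleared A c≢v rewrite c≡ = update-vertex 0 A c≢v
      gone : ∀ (A : ℕ → ℕ) → update (register s′ #c) 0 A (toℕ c) ≡ 0
      gone A rewrite c≡ = update-here (toℕ c) 0 A
      red-old : ∀ {v} → Reached K v → reds (exec reset s′) v ≡ ρ v
      red-old rv = trans (cleared (array s′ $red) (reached-≢ {L = K} rv ¬rc ∘ sym)) (reds≡ _)
      blue-old : ∀ {v} → Reached K v → blues (exec reset s′) v ≡ σ v
      blue-old rv = trans (cleared (array s′ $blue) (reached-≢ {L = K} rv ¬rc ∘ sym)) (blues≡ _)
      within : ∀ v → Reached ((p , c) ∷ K) v → ρ v + σ v + deg K v ≤ deg L v
      within v rv = begin
        ρ v + σ v + deg K v                                   ≤⟨ +-monoˡ-≤ (deg K v) (spent v) ⟩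
        δ p v + (reds s v + blues s v) + deg K v              ≡⟨ cong (_+ deg K v) (+-comm (δ p v) _) ⟩
        reds s v + blues s v + δ p v + deg K v                ≡⟨ +-assoc (reds s v + blues s v) (δ p v)
          (deg K v) ⟩
        reds s v + blues s v + (δ p v + deg K v)              ≤⟨ +-monoʳ-≤ (reds s v + blues s v)
          (+-monoʳ-≤ (δ p v) (m≤n+m (deg K v) (δ c v))) ⟩
        reds s v + blues s v + deg ((p , c) ∷ K) v            ≤⟨ budget v rv ⟩
        deg L v                                               ∎
        where open ≤-Reasoning
      idle′ : ∀ v → ¬ Reached K v → reds (exec reset s′) v + blues (exec reset s′) v ≡ 0
      idle′ v ¬rv with c ≟ᶠ v
      ... | yes refl = cong₂ _+_ (gone (array s′ $red)) (gone (array s′ $blue))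
      ... | no c≢v = trans (cong₂ _+_ (trans (cleared (array s′ $red) c≢v) (reds≡ v))
        (trans (cleared (array s′ $blue) c≢v) (blues≡ v)))
        (n≤0⇒n≡0 (≤-trans (spent v) (≤-reflexive
          (cong₂ _+_ (δ-≢ (reached-≢ {L = K} rp ¬rv)) (idle v [ c≢v ∘ sym , ¬rv ]′)))))

    module _ {p c : Fin (suc n)} {K : List (Edge (suc n))} {s : State} (pk : Picked p c K s) where

      private
        module F = Frame (Checking.frame (Picked.checking pk))
        open Picked pk
        open Checking checking
        r = reds s
        b = blues s
        OKred  = OK α β (suc (r c)) (b c) (deg L c)
        OKblue = OK α β (r c) (suc (b c)) (deg L c)

        known : ∀ {a a′ y y′ z z′ u u′ v v′} → a ≡ a′ → y ≡ y′ → z ≡ z′ → u ≡ u′ → v ≡ v′ →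
                OK a y z u v ≡ OK a′ y′ z′ u′ v′
        known refl refl refl refl refl = refl

        degree-c : array s $degree (register s #c) ≡ deg L c
        degree-c = trans (cong (array s $degree) reg-c) (Static.degrees F.static c)

        red-known : OK (register s #α) (register s #β) (suc (array s $red (register s #c)))
                       (array s $blue (register s #c)) (array s $degree (register s #c)) ≡ OKred
        red-known = known F.reg-α F.reg-β (cong (suc ∘ array s $red) reg-c)
          (cong (array s $blue) reg-c) degree-c

        blue-known : OK (register s #α) (register s #β) (array s $red (register s #c))
                        (suc (array s $blue (register s #c))) (array s $degree (register s #c)) ≡ OKblue
        blue-known = known F.reg-α F.reg-β (cong (array s $red) reg-c)
          (cong (suc ∘ array s $blue) reg-c) degree-c

        red⁻ : eval notRed s ≡ 0 → OKred
        red⁻ eq = subst id red-known (notOK⁻ (reg #α) (reg #β) (add (lit 1) (cell $red (reg #c)))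
          (cell $blue (reg #c)) (cell $degree (reg #c)) {s} eq)

        red⁺ : OKred → eval notRed s ≡ 0
        red⁺ ok = notOK⁺ (reg #α) (reg #β) (add (lit 1) (cell $red (reg #c)))
          (cell $blue (reg #c)) (cell $degree (reg #c)) {s} (subst id (sym red-known) ok)

        blue⁻ : eval notBlue s ≡ 0 → OKblue
        blue⁻ eq = subst id blue-known (notOK⁻ (reg #α) (reg #β) (cell $red (reg #c))
          (add (lit 1) (cell $blue (reg #c))) (cell $degree (reg #c)) {s} eq)

        blue⁺ : OKblue → eval notBlue s ≡ 0
        blue⁺ ok = notOK⁺ (reg #α) (reg #β) (cell $red (reg #c))
          (add (lit 1) (cell $blue (reg #c))) (cell $degree (reg #c)) {s} (subst id (sym blue-known) ok)

        bumped : ∀ (A : ℕ → ℕ) v → update (register s #p) (A (register s #p) + 1) A (toℕ v) ≡ δ p v + A (toℕ v)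
        bumped A v rewrite reg-p = increment p v A

        via : ∀ {F : Set} → Goal α β ⇔ Feasible α β (deg L) ((p , c) ∷ K) r b →
              Feasible α β (deg L) ((p , c) ∷ K) r b ⇔ F → Goal α β ⇔ F
        via f g = mk⇔ (to g ∘ to f) (from f ∘ from g)

      decide-settles : Checking (length K) K (exec reset (exec decide s))
      decide-settles with grown | budget
      ... | cons rp ¬rc G | budget = exec-cond P notRed redForbidden redAllowed s
        (λ red≢ → let ¬red = red≢ ∘ red⁺ in exec-cond P notBlue (set #bad (lit 1)) (increase $blue #p) s
          (λ blue≢ → settle {ρ = r} {b} pk
            record { Frame frame ; static = record { Static F.static } } reg-j reg-c (proj₂ (proj₂ stored))
            (λ _ → refl) (λ _ → refl) (λ v → m≤n+m _ (δ p v))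
            (inj₂ ((λ ()) , λ goal → [ (λ (_ , g) → feasible-neither α β (deg L) rp ¬rc G ¬red
              (blue≢ ∘ blue⁺) (to g goal))
                                     , (λ (_ , ¬goal) → ¬goal goal) ]′ verdict)))
          λ blue≡ → settle {ρ = r} {λ v → δ p v + b v} pk
            record { Frame frame ; static = record { Static F.static } } reg-j reg-c (proj₂ (proj₂ stored))
            (λ _ → refl) (bumped (array s $blue)) (λ v → ≤-reflexive (x∙yz≈y∙xz (r v) (δ p v) (b v)))
            (Sum.map₁ (Product.map₂ λ g → via g
              (feasible-only-blue α β (deg L) rp ¬rc G ¬red (blue⁻ blue≡))) verdict))
        λ red≡ → exec-cond P notBlue (increase $red #p) skip s
          (λ blue≢ → settle {ρ = λ v → δ p v + r v} {b} pk
            record { Frame frame ; static = record { Static F.static } } reg-j reg-c (proj₂ (proj₂ stored))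
            (bumped (array s $red)) (λ _ → refl) (λ v → ≤-reflexive (+-assoc (δ p v) (r v) (b v)))
            (Sum.map₁ (Product.map₂ λ g → via g
              (feasible-only-red α β (deg L) rp ¬rc G (red⁻ red≡) (blue≢ ∘ blue⁺))) verdict))
          λ blue≡ → settle {ρ = r} {b} pk
            record { Frame frame ; static = record { Static F.static } } reg-j reg-c (proj₂ (proj₂ stored))
            (λ _ → refl) (λ _ → refl) (λ v → m≤n+m _ (δ p v))
            (Sum.map₁ (Product.map₂ λ g → via g
              (feasible-either α β (deg L) rp ¬rc G (red⁻ red≡) (blue⁻ blue≡) free)) verdict)
        where
        open import Algebra.Properties.CommutativeSemigroup +-commutativeSemigroup using (x∙yz≈y∙xz)
        P : State → Set
        P s′ = Checking (length K) K (exec reset s′)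
        -- The edge from `p` to `c` is within the budget of `p` but not in `K`, which makes the
        -- inequality strict.
        free : r p + b p + deg K p < deg L p
        free = ≤-trans (≤-trans (≤-reflexive (sym (+-suc (r p + b p) (deg K p))))
          (+-monoʳ-≤ (r p + b p) (subst (λ z → suc (deg K p) ≤ z + (δ c p + deg K p)) (sym (δ-refl p))
            (s≤s (m≤n+m _ (δ c p))))))
          (budget p (inj₂ rp))

    module _ (G : Grown L) where

      Outcome : State → Set
      Outcome s = Clean {n} s × ((Goal α β × Frame D x 1 α β s) ⊎ (¬ Goal α β × Frame D x f α β s))

      -- With no edge left, the root is the only reached vertex and the only one whose counters can
      -- be nonzero. One test decides feasibility and two stores clean the arrays.
      checkRoot-outcome : ∀ {s} → Checking 0 [] s → Outcome (exec checkRoot s)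
      checkRoot-outcome {s} g = clean , exec-cond
        (λ s′ → (Goal α β × Frame D x 1 α β (zeroed s′)) ⊎
          (¬ Goal α β × Frame D x f α β (zeroed s′))) rootFails skip (set #found (lit 1)) s
        (λ ≢0 → inj₂ ((λ goal → [ (λ (b≡0 , g⇔) → ≢0 (cong₂ _+_ b≡0 (root-ok⁺ (to g⇔ goal)))) ,
          (λ (_ , ¬goal) → ¬goal goal) ]′ verdict)
                     , record { Frame frame ; static = record { Static F.static } }))
        λ ≡0 → inj₁ ([ (λ (_ , g⇔) → from g⇔ (root-ok⁻ (m+n≡0⇒n≡0 (register s #bad) ≡0)))
                     , (λ (b≢0 , _) → contradiction (m+n≡0⇒m≡0 (register s #bad) ≡0) b≢0) ]′ verdict
                     , record { Frame frame ; static = record { Static F.static } ; reg-found = refl })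
        where
        open Checking g
        module F = Frame frame
        zeroed : State → State
        zeroed = exec (store $red (lit 0) (lit 0) ⨾ store $blue (lit 0) (lit 0))
        rootE : Expr
        rootE = notOKE (reg #α) (reg #β) (cell $red (lit 0)) (cell $blue (lit 0)) (cell $degree (lit 0))
        known : OK (register s #α) (register s #β) (array s $red 0) (array s $blue 0) (array s $degree 0) ≡
                OK α β (reds s root + 0) (blues s root + 0) (deg L root)
        known rewrite F.reg-α | F.reg-β | Static.degrees F.static root | +-identityʳ
          (array s $red 0) | +-identityʳ (array s $blue 0) = refl
        root-ok⁺ : Feasible α β (deg L) [] (reds s) (blues s) → eval rootE s ≡ 0
        root-ok⁺ (.[] , .[] , [] , ok) = notOK⁺ (reg #α) (reg #β) (cell $red (lit 0))
          (cell $blue (lit 0)) (cell $degree (lit 0)) {s}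
          (subst id (sym known) (ok root refl))
        root-ok⁻ : eval rootE s ≡ 0 → Feasible α β (deg L) [] (reds s) (blues s)
        root-ok⁻ eq = [] , [] , [] , λ { _ refl →
          subst id known (notOK⁻ (reg #α) (reg #β) (cell $red (lit 0)) (cell $blue (lit 0))
            (cell $degree (lit 0)) {s} eq) }
        zero-at-0 : ∀ (A : ℕ → ℕ) → (∀ v → v ≢ root → A (toℕ v) ≡ 0) → ∀ (v : Fin (suc n)) →
          update 0 0 A (toℕ v) ≡ 0
        zero-at-0 A A≡0 zero    = refl
        zero-at-0 A A≡0 (suc v) = A≡0 (suc v) λ ()
        clean : Clean {n} (exec checkRoot s)
        clean = exec-cond (λ s′ → Clean {n} (zeroed s′)) rootFails skip (set #found (lit 1)) s
          (λ _ → c) (λ _ → record { Clean c })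
          where
          c : Clean {n} (zeroed s)
          c = record
            { red-0  = zero-at-0 (array s $red) λ v ¬root → m+n≡0⇒m≡0 (reds s v) (idle v ¬root)
            ; blue-0 = zero-at-0 (array s $blue) λ v ¬root → m+n≡0⇒n≡0 (reds s v) (idle v ¬root) }

      runs-check : ∀ {s} → Frame D x f α β s → Clean {n} s → Runs check s (checkSteps n) Outcome
      runs-check {s} fr cl =
        runs-seq {p = set #j (reg #k) ⨾ set #bad (lit 0)}
          (runs-exec (set #j (reg #k) ⨾ set #bad (lit 0)) {Q = Checking (length L) L} _ start) λ s₁ g →
        runs-seq {p = while (reg #j) checkStep}
          (runs-while I (time checkStep) step n (grown-length G) (L , g , refl)) λ s₂
            (done , _ , K , g , _) →
        runs-exec checkRoot _ (end K g done)
        where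
        I : ℕ → State → Set
        I k s = ∃ λ K → Checking (length K) K s × k ≡ length K
        step : ∀ k s → I k s → eval (reg #j) s ≢ 0 → Runs checkStep s (time checkStep) λ s′ → ∃ λ k′ →
          k′ < k × I k′ s′
        step _ s ([] , g , refl) ≢0 = contradiction (Checking.reg-j g) ≢0
        step _ s ((p , c) ∷ K , g , refl) _ = runs-exec checkStep _
          (length K , ≤-refl , K , decide-settles (pick-picked g) , refl)
        end : ∀ K {s} → Checking (length K) K s → register s #j ≡ 0 → Outcome (exec checkRoot s)
        end []      g _  = checkRoot-outcome g
        end (_ ∷ _) g ≡0 = case trans (sym (Checking.reg-j g)) ≡0 of λ ()
        open Clean cl
        start : Checking (length L) L (exec (set #j (reg #k) ⨾ set #bad (lit 0)) s)
        start = record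
          { frame = record { Frame fr ; static = record { Static (Frame.static fr) } }
          ; reg-j = Static.reg-k (Frame.static fr)
          ; stored = Static.stored (Frame.static fr)
          ; grown = G
          ; budget = λ v _ → ≤-reflexive (cong₂ (λ r b → r + b + deg L v) (red-0 v) (blue-0 v))
          ; idle = λ v _ → cong₂ _+_ (red-0 v) (blue-0 v)
          ; verdict = inj₁ (refl , mk⇔
              (feasible-mono α β (deg L) (λ v _ → ≤-reflexive (red-0 v)) (λ v _ → ≤-reflexive (blue-0 v)))
              (feasible-mono α β (deg L) (λ _ _ → z≤n) (λ _ _ → z≤n)))
          }

  record Base (D x : ℕ) (s : State) : Set where
    field
      static : Static L s
      clean  : Clean {n} s
      reg-D  : register s #D ≡ D
      reg-x  : register s #x ≡ x

  Success : Set
  Success = ∃₂ λ α β → Goal α β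

  -- Tried collects the refutations of the pairs tried so far.
  Found : Set → State → Set
  Found Tried s = (register s #found ≡ 1 × Success) ⊎ (register s #found ≡ 0 × Tried)

  module _ (G : Grown L) {D : ℕ} where

    runs-try : ∀ {x α β s Tried} e f → eval e s ≡ α → eval f (setRegister #α (eval e s) s) ≡ β →
      Base D x s × Found Tried s →
      Runs (tryPair e f) s (tryPairSteps e f n) λ s′ → Base D x s′ × Found (Tried × ¬ Goal α β) s′
    runs-try {x} {α} {β} {s} {Tried} e f e≡ f≡ (base , found) =
      runs-seq {p = set #α e ⨾ set #β f} (runs-exec (set #α e ⨾ set #β f) {Q = Ready} _ ready)
        λ { s₁ (clean , φ , fr , known) → finish known (runs-check G fr clean) }
      where
      Known : ℕ → Set
      Known φ = (φ ≡ 1 × Success) ⊎ (φ ≡ 0 × Tried)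
      Ready : State → Set
      Ready s′ = Clean {n} s′ × ∃ λ φ → Frame D x φ α β s′ × Known φ
      open Base base
      ready : Ready (exec (set #α e ⨾ set #β f) s)
      ready = record { Clean clean } , register s #found , record
        { static = record { Static static } ; reg-D = reg-D ; reg-x = reg-x ; reg-found = refl ; reg-α = e≡ ; reg-β = f≡ }
        , found
      finish : ∀ {φ s₁ T} → Known φ → Runs check s₁ T (Outcome {D} {x} {φ} {α} {β} G) →
        Runs check s₁ T λ s′ → Base D x s′ × Found (Tried × ¬ Goal α β) s′
      finish known (t , s′ , R , t≤ , clean , inj₁ (goal , fr)) = t , s′ , R , t≤ ,
        record { Frame fr ; clean = clean } , inj₁ (Frame.reg-found fr , α , β , goal)
      finish known (t , s′ , R , t≤ , clean , inj₂ (¬goal , fr)) = t , s′ , R , t≤ ,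
        record { Frame fr ; clean = clean } ,
        Sum.map (Product.map₁ (trans (Frame.reg-found fr)))
          (Product.map (trans (Frame.reg-found fr)) (_, ¬goal)) known

    Searching : ℕ → State → Set
    Searching x s = Base D x s × Found (∀ y α β → y < x → Candidate D y α β → ¬ Goal α β) s

    runs-searchStep : ∀ {x s} → Searching x s → Runs searchStep s (searchStepSteps n) (Searching (suc x))
    runs-searchStep {x} {s} base-found@(base , _) =
      runs-seq {p = tryPair (reg #D) (reg #x)}
        (runs-try {x} {D} {x} (reg #D) (reg #x) (Base.reg-D base) (Base.reg-x base) base-found) λ s₁ g₁ →
      runs-seq {p = tryPair (sub (reg #D) (lit 1)) (reg #x)}
        (runs-try {x} {D ∸ 1} {x} (sub (reg #D) (lit 1)) (reg #x) (cong (_∸ 1) (Base.reg-D (proj₁ g₁)))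
          (Base.reg-x (proj₁ g₁)) g₁) λ s₂ g₂ →
      runs-seq {p = tryPair (reg #x) (sub (reg #D) (reg #x))}
        (runs-try {x} {x} {D ∸ x} (reg #x) (sub (reg #D) (reg #x)) (Base.reg-x (proj₁ g₂))
          (cong₂ _∸_ (Base.reg-D (proj₁ g₂)) (Base.reg-x (proj₁ g₂))) g₂) λ s₃ (base₃ , found₃) →
      runs-exec (set #x (add (reg #x) (lit 1))) _
        ( record { static = record { Static (Base.static base₃) } ; clean = record { Clean
          (Base.clean base₃) }
                 ; reg-D = Base.reg-D base₃ ; reg-x = trans (cong (_+ 1) (Base.reg-x base₃)) (+-comm x 1) }
        , Sum.map₂ (Product.map₂ λ (((tried , ¬full) , ¬almost) , ¬sum) y _ _ y<1+x → case m≤n⇒m<n∨m≡n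
          (s≤s⁻¹ y<1+x) of λ where
            (inj₁ y<x)  → tried y _ _ y<x
            (inj₂ refl) → λ { full → ¬full ; almost → ¬almost ; sum → ¬sum }) found₃)

    runs-search : ∀ {s} → Static L s → Clean {n} s → register s #D ≡ D → Runs search s (searchSteps n)
      (Found (∀ y α β → y ≤ suc n → Candidate D y α β → ¬ Goal α β))
    runs-search {s} st cl D≡ =
      runs-seq {p = set #found (lit 0) ⨾ set #x (lit 0)}
        (runs-exec (set #found (lit 0) ⨾ set #x (lit 0)) {Q = Searching 0} _
          ( record { static = record { Static st } ; clean = record { Clean cl } ; reg-D = D≡ ; reg-x = refl }
          , inj₂ (refl , λ _ _ _ ()))) λ s₁ g →
        finish (runs-while I (searchStepSteps n) step (suc (suc n)) ≤-refl (0 , g , refl))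
      where
      I : ℕ → State → Set
      I k s = ∃ λ x → Searching x s × k ≡ suc (suc n) ∸ x
      guard = sub (add (reg #n) (lit 1)) (reg #x)
      guard≡ : ∀ {x s} → Searching x s → eval guard s ≡ suc (suc n) ∸ x
      guard≡ {x} (base , _) = cong₂ _∸_
        (trans (cong (_+ 1) (Static.reg-n (Base.static base))) (+-comm (suc n) 1)) (Base.reg-x base)
      step : ∀ k s → I k s → eval guard s ≢ 0 → Runs searchStep s (searchStepSteps n) λ s′ → ∃ λ k′ →
        k′ < k × I k′ s′
      step _ s (x , g , refl) ≢0 = let t , s′ , R , t≤ , g′ = runs-searchStep g in t , s′ , R , t≤ , _ ,
        ∸-monoʳ-< (n<1+n x) (m∸n≢0⇒n<m (≢0 ∘ trans (guard≡ g))) , suc x , g′ , refl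
      finish : ∀ {s T} → Runs (while guard searchStep) s T (λ s′ → eval guard s′ ≡ 0 × ∃ λ k → I k s′) →
        Runs (while guard searchStep) s T (Found (∀ y α β → y ≤ suc n → Candidate D y α β → ¬ Goal α β))
      finish (t , s′ , R , t≤ , done , _ , x , g , _) = t , s′ , R , t≤ ,
        Sum.map₂ (Product.map₂ λ tried y _ _ y≤ → tried y _ _
          (≤-trans (s≤s y≤) (m∸n≡0⇒m≤n (trans (sym (guard≡ g)) done)))) (proj₂ g)

-- The whole program and its correctness

wrProgram : Program
wrProgram = growth ⨾ maxDegree ⨾ search ⨾ set #n (reg #found)

wrSteps : ℕ → ℕ → ℕ
wrSteps n m = growthSteps n m + (maxDegreeSteps n + (searchSteps n + time (set #n (reg #found))))

-- The bound on `length es` is part of the postcondition because it is read off the spanning list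
-- that the growth phase produces.
runs-wrProgram : ∀ {n} (T : Graph (suc n)) → vertices T ≡ ⊤ → IsTree T → ∀ es → IsEdgeList T es →
  Runs wrProgram (input (suc n) es) (wrSteps n (length es)) λ s →
    length es ≤ suc n × ((wr≤ T 2 × output s ≡ 1) ⊎ (¬ wr≤ T 2 × output s ≡ 0))
runs-wrProgram {n} T V≡⊤ tree es isList =
  runs-seq {p = growth} (Growth.runs-growth T es isList tree V≡⊤)
  λ s₁ (L , static , clean , G , reached , span) →
  runs-seq {p = maxDegree} (runs-maxDegree static clean) λ s₂ maxed →
  let open Maxed maxed using (bound; attained) in
  runs-seq {p = search} (runs-search G (Maxed.static maxed) (Maxed.clean maxed) refl) λ s₃ found →
  runs-exec (set #n (reg #found)) _
    ( forest-edges≤ (proj₁ span) (proj₂ isList)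
      (λ i → proj₂ (proj₂ span) (from (proj₁ isList _ _) (inj₁ i)))
    , Sum.map
        (λ (f≡1 , α , β , goal) →
          let _ , _ , sp , SR , SB = feasible⇒semi reached goal in split⇒wr≤2 span sp SR SB , f≡1)
        (λ (f≡0 , none) → (λ wr →
          let _ , _ , sp , SR , SB = wr≤2⇒split span wr
              _ , _ , _ , y≤ , cand , _ , _ , sp′ , SR′ , SB′ =
                candidate sp bound (proj₂ attained) (deg≤N {T = T} span) SR SB
          in none _ _ _ y≤ cand (semi⇒feasible sp′ SR′ SB′)) , f≡0) found)

-- Polynomial time bounds

-- The argument n stands for suc n vertices.
record Poly (k : ℕ) (f : ℕ → ℕ) : Set where
  constructor bounded
  field
    coefficient : ℕ
    bound       : ∀ n → f n ≤ coefficient * suc n ^ k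

open Poly

poly-const : ∀ {k} c → Poly k λ _ → c
poly-const {k} c = bounded c λ n → m≤m*n c (suc n ^ k) {{m^n≢0 (suc n) k}}

poly-suc : Poly 1 suc
poly-suc = bounded 1 λ n → ≤-reflexive (sym (trans (*-identityˡ (suc n ^ 1)) (*-identityʳ (suc n))))

poly-+ : ∀ {k f g} → Poly k f → Poly k g → Poly k λ n → f n + g n
poly-+ {k} (bounded C f≤) (bounded C′ g≤) = bounded (C + C′) λ n →
  ≤-trans (+-mono-≤ (f≤ n) (g≤ n)) (≤-reflexive (sym (*-distribʳ-+ (suc n ^ k) C C′)))

poly-* : ∀ {j k f g} → Poly j f → Poly k g → Poly (j + k) λ n → f n * g n
poly-* {j} {k} (bounded C f≤) (bounded C′ g≤) = bounded (C * C′) λ n →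
  ≤-trans (*-mono-≤ (f≤ n) (g≤ n)) (≤-reflexive
    (trans (interchange C (suc n ^ j) C′ (suc n ^ k))
      (cong (C * C′ *_) (sym (^-distribˡ-+-* (suc n) j k)))))
  where open import Algebra.Properties.CommutativeSemigroup *-commutativeSemigroup using (interchange)

poly-≤ : ∀ {j k f} → j ≤ k → Poly j f → Poly k f
poly-≤ j≤k (bounded C f≤) = bounded C λ n → ≤-trans (f≤ n) (*-monoʳ-≤ C (^-monoʳ-≤ (suc n) j≤k))

poly-growth : Poly 2 λ n → growthSteps n (suc n)
poly-growth = poly-+ (poly-const (time (store $seen (lit 0) (lit 1))))
  (poly-* {2} {0} (poly-+ (poly-const 1)
    (poly-+ (poly-* {1} {1} poly-suc (poly-+ (poly-const 1) poly-suc)) (poly-≤ (s≤s z≤n) poly-suc)))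
    (poly-const (suc (cost (sub (reg #m) (reg #i))) + time scan)))

poly-maxDegree : Poly 2 maxDegreeSteps
poly-maxDegree = poly-+ (poly-const (time (set #D (lit 0)))) (poly-+ (poly-const (time (set #x (lit 0))))
  (poly-≤ (s≤s z≤n) (poly-* {1} {0} (poly-+ (poly-const 1) poly-suc)
    (poly-const (suc (cost (sub (reg #n) (reg #x))) + time maxDegreeStep)))))

poly-check : Poly 1 checkSteps
poly-check = poly-+ (poly-const (time (set #j (reg #k) ⨾ set #bad (lit 0))))
  (poly-+ (poly-* {1} {0} poly-suc (poly-const (suc (cost (reg #j)) + time checkStep)))
    (poly-const (time checkRoot)))

poly-tryPair : ∀ e f → Poly 1 (tryPairSteps e f)
poly-tryPair e f = poly-+ (poly-const (time (set #α e ⨾ set #β f))) poly-check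

poly-searchStep : Poly 1 searchStepSteps
poly-searchStep = poly-+ (poly-tryPair (reg #D) (reg #x))
  (poly-+ (poly-tryPair (sub (reg #D) (lit 1)) (reg #x))
  (poly-+ (poly-tryPair (reg #x) (sub (reg #D) (reg #x)))
    (poly-const (time (set #x (add (reg #x) (lit 1)))))))

poly-search : Poly 2 searchSteps
poly-search = poly-+ (poly-const (time (set #found (lit 0) ⨾ set #x (lit 0))))
  (poly-* {1} {1} (poly-+ (poly-const 2) poly-suc)
    (poly-+ (poly-const (suc (cost (sub (add (reg #n) (lit 1)) (reg #x))))) poly-searchStep))

poly-wr : Poly 2 λ n → wrSteps n (suc n)
poly-wr = poly-+ poly-growth (poly-+ poly-maxDegree
  (poly-+ poly-search (poly-const (time (set #n (reg #found))))))

wrSteps-mono : ∀ n {m m′} → m ≤ m′ → wrSteps n m ≤ wrSteps n m′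
wrSteps-mono n m≤m′ = +-monoˡ-≤ _ (+-monoʳ-≤ (time (store $seen (lit 0) (lit 1)))
  (*-monoˡ-≤ (suc (cost (sub (reg #m) (reg #i))) + time scan)
    (s≤s (+-mono-≤ (*-monoʳ-≤ (suc n) (s≤s m≤m′)) m≤m′))))

wr≤2-decider : DecidesOnTrees wrProgram (λ T → wr≤ T 2) (λ n → coefficient poly-wr * n ^ 2)
wr≤2-decider zero    T V≡⊤ (((() , _) , _) , _) es isList
wr≤2-decider (suc n) T V≡⊤ tree es isList =
  let t , s , R , t≤ , m≤N , answer = runs-wrProgram T V≡⊤ tree es isList
  in t , s , R , ≤-trans t≤ (≤-trans (wrSteps-mono n m≤N) (bound poly-wr n)) , answer

theorem1 : ∃₂ λ (p : Program) (f : ℕ → ℕ) →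
    f ∈O (λ n → n ^ 2) × DecidesOnTrees p (λ T → wr≤ T 2) f
theorem1 = wrProgram , (λ n → coefficient poly-wr * n ^ 2) ,
  (coefficient poly-wr , 0 , λ _ _ → ≤-refl) , wr≤2-decider
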